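{- Let $n\geq 1$, $q\geq 2$ and $s\geq 0$ be integers. For each $1\leq i\leq n$ let $A_i\subseteq \mathbb{R}$ be a subset with $|A_i|=q$, and consider the box $\mathcal{B}:=\prod_{i=1}^n A_i\subseteq \mathbb{R}^n$. Suppose that $\mathcal{F}\subseteq \mathcal{B}$ is a set such that $|d(\mathcal{F})|\leq s$. Then $$ |\mathcal{F}|\leq 2\cdot \Big|\Big\{x_1^{\alpha_1}\cdots x_n^{\alpha_n}:~ 0\leq \alpha_i \leq q-1 \text{ for each } 1\le i\le n,\ \sum_{i=1}^n \alpha_i \leq s \Big\}\Big|, $$ where the set on the right is a set of monomials in the variables $x_1,\dots,x_n$ with integer exponents $\alpha_i$.
   Context: For a set $\mathcal{G}\subseteq\mathbb{R}^n$, $d(\mathcal{G})$ denotes the set of non-zero Euclidean distances among points of $\mathcal{G}$: $d(\mathcal{G}):=\{d(\mathbf{p}_1,\mathbf{p}_2): \mathbf{p}_1,\mathbf{p}_2\in\mathcal{G},\ \mathbf{p}_1\neq\mathbf{p}_2\}$, where $d(\mathbf{p}_1,\mathbf{p}_2)$ is the Euclidean distance. -}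

module Defs where

open import Data.Nat.Base as ℕ using (ℕ; zero; suc)
import Data.Nat.Properties as ℕ
open import Data.Integer.Base as ℤ using (+_)
import Data.Integer.Properties as ℤ
open import Data.Rational.Base hiding (_⊔_)
open import Data.Rational.Properties
import Data.Rational.Unnormalised.Base as ℚᵘ
import Data.Rational.Unnormalised.Properties as ℚᵘ
open import Data.Rational.Solver using (module +-*-Solver)
open import Data.Fin.Base using (Fin)
open import Data.Product.Base using (Σ; ∃; ∃₂; _×_; _,_; proj₁; proj₂)
open import Data.Sum.Base using (_⊎_; inj₁; inj₂; map₁)
open import Data.Empty using (⊥-elim)
open import Data.Vec.Base as Vec using (Vec)
open import Data.Vec.Functional using (Vector; foldr)
import Data.Vec.Functional.Relation.Binary.Equality.Setoid as Pointwise
open import Function.Bundles using (Bijection; Injection)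
open import Level using (Level; 0ℓ; _⊔_)
open import Relation.Binary.Bundles using (Setoid)
import Relation.Binary.Construct.On as On
open import Relation.Binary.PropositionalEquality
  using (_≡_; refl; sym; trans; cong; cong₂; subst; subst₂; setoid)
open import Relation.Nullary using (¬_; Dec; yes; no)
open import Relation.Unary using (Pred; _∈_)

private
  variable
    a ℓ p : Level

_∣_ : (S : Setoid a ℓ) → Pred (Setoid.Carrier S) p → Setoid (a ⊔ p) ℓ
S ∣ P = On.setoid {B = Σ (Setoid.Carrier S) P} S proj₁

-- P need not respect the equality of S: its elements are counted up to that
-- equality.
HasCardinality : (S : Setoid a ℓ) → Pred (Setoid.Carrier S) p → ℕ → Set (a ⊔ ℓ ⊔ p)
HasCardinality S P k = Bijection (setoid (Fin k)) (S ∣ P)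

-- |P| ≤ k, read as: any finitely many pairwise distinct elements of P number
-- at most k.  No finiteness or decidability of P is presupposed.
CardinalityAtMost : (S : Setoid a ℓ) → Pred (Setoid.Carrier S) p → ℕ → Set (a ⊔ ℓ ⊔ p)
CardinalityAtMost S P k = ∀ {m} → Injection (setoid (Fin m)) (S ∣ P) → m ℕ.≤ k

private
  abs< : ∀ {x ε} → x < ε → - x < ε → ∣ x ∣ < ε
  abs< {x} x<ε -x<ε with ∣p∣≡p∨∣p∣≡-p x
  ... | inj₁ eq = subst (_< _) (sym eq) x<ε
  ... | inj₂ eq = subst (_< _) (sym eq) -x<ε

  x≤∣x∣ : ∀ x → x ≤ ∣ x ∣
  x≤∣x∣ x with ≤-total 0ℚ x
  ... | inj₁ 0≤x = ≤-reflexive (sym (0≤p⇒∣p∣≡p 0≤x))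
  ... | inj₂ x≤0 = ≤-trans x≤0 (0≤∣p∣ x)

  ∣x-y∣≡∣y-x∣ : ∀ x y → ∣ x - y ∣ ≡ ∣ y - x ∣
  ∣x-y∣≡∣y-x∣ x y = trans (sym (∣-p∣≡∣p∣ (x - y)))
    (cong ∣_∣ (solve 2 (λ x y → :- (x :- y) := y :- x) refl x y))
    where open +-*-Solver

  half : ℚ → ℚ
  half ε = ½ * ε

  half>0 : ∀ {ε} → 0ℚ < ε → 0ℚ < half ε
  half>0 {ε} 0<ε = positive⁻¹ (half ε) {{pos*pos⇒pos ½ ε {{positive 0<ε}}}}

  half+half : ∀ ε → half ε + half ε ≡ ε
  half+half ε = trans (sym (*-distribʳ-+ ε ½ ½)) (*-identityˡ ε)

  split : ∀ {x y z ε} → x ≡ y + z → ∣ y ∣ < half ε → ∣ z ∣ < half ε → ∣ x ∣ < ε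
  split {x} {y} {z} {ε} refl y< z< = ≤-<-trans (∣p+q∣≤∣p∣+∣q∣ y z)
    (subst (∣ y ∣ + ∣ z ∣ <_) (half+half ε) (+-mono-< y< z<))

  sq-mono-≤ : ∀ {x y} → 0ℚ ≤ x → x ≤ y → x * x ≤ y * y
  sq-mono-≤ {x} {y} 0≤x x≤y =
    ≤-trans (*-monoˡ-≤-nonNeg x {{nonNegative 0≤x}} x≤y)
            (*-monoʳ-≤-nonNeg y {{nonNegative (≤-trans 0≤x x≤y)}} x≤y)

  scale : ∀ B C ε → 0ℚ < B → 0ℚ < C → 0ℚ < ε → ∃ λ η → 0ℚ < η × B * η + C * η ≡ ε
  scale B C ε 0<B 0<C 0<ε = η , 0<η , Bη+Cη≡ε
    where
    instance
      D-pos : Positive (B + C)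
      D-pos = positive (+-mono-< 0<B 0<C)
      D-nonZero : NonZero (B + C)
      D-nonZero = pos⇒nonZero (B + C)
    η : ℚ
    η = 1/ (B + C) * ε
    0<η : 0ℚ < η
    0<η = positive⁻¹ η {{pos*pos⇒pos (1/ (B + C)) {{1/pos⇒pos (B + C)}} ε {{positive 0<ε}}}}
    Bη+Cη≡ε : B * η + C * η ≡ ε
    Bη+Cη≡ε = trans (sym (*-distribʳ-+ η B C))
             (trans (sym (*-assoc (B + C) (1/ (B + C)) ε))
             (trans (cong (_* ε) (*-inverseʳ (B + C))) (*-identityˡ ε)))

  ∣*∣-small : ∀ D η t u → 0ℚ < D → ∣ t ∣ ≤ D → ∣ u ∣ < η → ∣ t * u ∣ < D * η
  ∣*∣-small D η t u 0<D t≤D u<η = ≤-<-trans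
    (≤-trans (≤-reflexive (∣p*q∣≡∣p∣*∣q∣ t u))
             (*-monoʳ-≤-nonNeg ∣ u ∣ {{∣-∣-nonNeg u}} t≤D))
    (*-monoʳ-<-pos D {{positive 0<D}} u<η)

  *-close : ∀ B C η a b c d → 0ℚ < B → 0ℚ < C → ∣ a ∣ ≤ B → ∣ d ∣ ≤ C →
            ∣ a - c ∣ < η → ∣ b - d ∣ < η → ∣ a * b - c * d ∣ < B * η + C * η
  *-close B C η a b c d 0<B 0<C a≤B d≤C a-c b-d = ≤-<-trans
    (subst (λ t → ∣ t ∣ ≤ ∣ a * (b - d) ∣ + ∣ d * (a - c) ∣)
      (solve 4 (λ a b c d → a :* (b :- d) :+ d :* (a :- c) := a :* b :- c :* d) refl a b c d)
      (∣p+q∣≤∣p∣+∣q∣ (a * (b - d)) (d * (a - c))))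
    (+-mono-< (∣*∣-small B η a (b - d) 0<B a≤B b-d)
              (∣*∣-small C η d (a - c) 0<C d≤C a-c))
    where open +-*-Solver

  ⊔-≤ˡ : ∀ {M N k} → M ℕ.⊔ N ℕ.≤ k → M ℕ.≤ k
  ⊔-≤ˡ {M} {N} = ℕ.m⊔n≤o⇒m≤o M N

  ⊔-≤ʳ : ∀ {M N k} → M ℕ.⊔ N ℕ.≤ k → N ℕ.≤ k
  ⊔-≤ʳ {M} {N} = ℕ.m⊔n≤o⇒n≤o M N

IsCauchy : (ℕ → ℚ) → Set
IsCauchy x = ∀ ε → 0ℚ < ε → ∃ λ N → ∀ m n → N ℕ.≤ m → N ℕ.≤ n → ∣ x m - x n ∣ < ε

-- The reals are Cauchy sequences of rationals, not quotiented: equality of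
-- reals is the equivalence _≈_ below, never _≡_.
record ℝ : Set where
  constructor mkℝ
  field
    seq    : ℕ → ℚ
    cauchy : IsCauchy seq

open ℝ public

infix 4 _≈_
_≈_ : ℝ → ℝ → Set
x ≈ y = ∀ ε → 0ℚ < ε → ∃ λ N → ∀ n → N ℕ.≤ n → ∣ seq x n - seq y n ∣ < ε

≈-refl : ∀ {x} → x ≈ x
≈-refl {x} ε 0<ε = 0 , λ n _ → subst (_< ε) (cong ∣_∣ (sym (+-inverseʳ (seq x n)))) 0<ε

≈-sym : ∀ {x y} → x ≈ y → y ≈ x
≈-sym {x} {y} x≈y ε 0<ε with x≈y ε 0<ε
... | N , h = N , λ n N≤n → subst (_< ε) (∣x-y∣≡∣y-x∣ (seq x n) (seq y n)) (h n N≤n)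

≈-trans : ∀ {x y z} → x ≈ y → y ≈ z → x ≈ z
≈-trans {x} {y} {z} x≈y y≈z ε 0<ε
  with x≈y (half ε) (half>0 0<ε) | y≈z (half ε) (half>0 0<ε)
... | M , h | N , k = M ℕ.⊔ N , λ n MN≤n →
  split (solve 3 (λ x y z → x :- z := (x :- y) :+ (y :- z)) refl (seq x n) (seq y n) (seq z n))
        (h n (⊔-≤ˡ {M} {N} MN≤n)) (k n (⊔-≤ʳ {M} {N} MN≤n))
  where open +-*-Solver

ℝ-setoid : Setoid 0ℓ 0ℓ
ℝ-setoid = record
  { Carrier       = ℝ
  ; _≈_           = _≈_
  ; isEquivalence = record
    { refl  = λ {x} → ≈-refl {x}
    ; sym   = λ {x} {y} → ≈-sym {x} {y}
    ; trans = λ {x} {y} {z} → ≈-trans {x} {y} {z}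
    }
  }

0ℝ : ℝ
0ℝ = mkℝ (λ _ → 0ℚ) (λ ε 0<ε → 0 , λ _ _ _ _ → 0<ε)

infixl 6 _+ℝ_ _-ℝ_
infixl 7 _*ℝ_

_+ℝ_ : ℝ → ℝ → ℝ
x +ℝ y = mkℝ (λ n → seq x n + seq y n) isCauchy
  where
  open +-*-Solver
  isCauchy : IsCauchy (λ n → seq x n + seq y n)
  isCauchy ε 0<ε with cauchy x (half ε) (half>0 0<ε) | cauchy y (half ε) (half>0 0<ε)
  ... | M , h | N , k = M ℕ.⊔ N , λ m n ≤m ≤n →
    split (solve 4 (λ a b c d → (a :+ b) :- (c :+ d) := (a :- c) :+ (b :- d)) refl
             (seq x m) (seq y m) (seq x n) (seq y n))
          (h m n (⊔-≤ˡ {M} {N} ≤m) (⊔-≤ˡ {M} {N} ≤n))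
          (k m n (⊔-≤ʳ {M} {N} ≤m) (⊔-≤ʳ {M} {N} ≤n))

-ℝ_ : ℝ → ℝ
-ℝ x = mkℝ (λ n → - seq x n) isCauchy
  where
  open +-*-Solver
  isCauchy : IsCauchy (λ n → - seq x n)
  isCauchy ε 0<ε with cauchy x ε 0<ε
  ... | N , h = N , λ m n ≤m ≤n → subst (λ t → ∣ t ∣ < ε)
    (solve 2 (λ a b → a :- b := :- b :- :- a) refl (seq x n) (seq x m)) (h n m ≤n ≤m)

_-ℝ_ : ℝ → ℝ → ℝ
x -ℝ y = x +ℝ (-ℝ y)

eventuallyBounded : ∀ x → ∃₂ λ B N → 0ℚ < B × (∀ n → N ℕ.≤ n → ∣ seq x n ∣ ≤ B)
eventuallyBounded x with cauchy x 1ℚ (positive⁻¹ 1ℚ)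
... | N , h = 1ℚ + ∣ seq x N ∣ , N
            , +-mono-<-≤ (positive⁻¹ 1ℚ) (0≤∣p∣ (seq x N))
            , λ n N≤n → ≤-trans
                (subst (_≤ ∣ seq x n - seq x N ∣ + ∣ seq x N ∣)
                  (cong ∣_∣ (solve 2 (λ a b → (a :- b) :+ b := a) refl (seq x n) (seq x N)))
                  (∣p+q∣≤∣p∣+∣q∣ (seq x n - seq x N) (seq x N)))
                (+-monoˡ-≤ ∣ seq x N ∣ (<⇒≤ (h n N N≤n ℕ.≤-refl)))
  where open +-*-Solver

private
  Bounded : (ℕ → ℚ) → Set
  Bounded f = ∃₂ λ B N → 0ℚ < B × (∀ n → N ℕ.≤ n → ∣ f n ∣ ≤ B)

  *-cauchy : ∀ f g → IsCauchy f → IsCauchy g → Bounded f → Bounded g → IsCauchy (λ n → f n * g n)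
  *-cauchy f g f-cauchy g-cauchy (B , M₁ , 0<B , f≤B) (C , M₂ , 0<C , g≤C) ε 0<ε =
    step₁ (scale B C ε 0<B 0<C 0<ε)
    where
    Goal : Set
    Goal = ∃ λ N → ∀ m n → N ℕ.≤ m → N ℕ.≤ n → ∣ f m * g m - f n * g n ∣ < ε

    Close : (ℕ → ℚ) → ℚ → Set
    Close f η = ∃ λ N → ∀ m n → N ℕ.≤ m → N ℕ.≤ n → ∣ f m - f n ∣ < η

    step₂ : ∀ η → B * η + C * η ≡ ε → Close f η → Close g η → Goal
    step₂ η Bη+Cη≡ε (N₁ , h) (N₂ , k) = (M₁ ℕ.⊔ M₂) ℕ.⊔ (N₁ ℕ.⊔ N₂) , λ m n ≤m ≤n →
      let M≤m = ⊔-≤ˡ {M₁ ℕ.⊔ M₂} {N₁ ℕ.⊔ N₂} ≤m ; N≤m = ⊔-≤ʳ {M₁ ℕ.⊔ M₂} {N₁ ℕ.⊔ N₂} ≤m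
          M≤n = ⊔-≤ˡ {M₁ ℕ.⊔ M₂} {N₁ ℕ.⊔ N₂} ≤n ; N≤n = ⊔-≤ʳ {M₁ ℕ.⊔ M₂} {N₁ ℕ.⊔ N₂} ≤n
      in subst (∣ f m * g m - f n * g n ∣ <_) Bη+Cη≡ε
           (*-close B C η (f m) (g m) (f n) (g n) 0<B 0<C
             (f≤B m (⊔-≤ˡ {M₁} {M₂} M≤m)) (g≤C n (⊔-≤ʳ {M₁} {M₂} M≤n))
             (h m n (⊔-≤ˡ {N₁} {N₂} N≤m) (⊔-≤ˡ {N₁} {N₂} N≤n))
             (k m n (⊔-≤ʳ {N₁} {N₂} N≤m) (⊔-≤ʳ {N₁} {N₂} N≤n)))

    step₁ : (∃ λ η → 0ℚ < η × B * η + C * η ≡ ε) → Goal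
    step₁ (η , 0<η , Bη+Cη≡ε) = step₂ η Bη+Cη≡ε (f-cauchy η 0<η) (g-cauchy η 0<η)

_*ℝ_ : ℝ → ℝ → ℝ
x *ℝ y = mkℝ (λ n → seq x n * seq y n)
  (*-cauchy (seq x) (seq y) (cauchy x) (cauchy y) (eventuallyBounded x) (eventuallyBounded y))

grid : ℕ → ℕ → ℚ
grid n k = + k / suc n

-- The largest k ≤ K with P k, or 0 if there is none.
largest : {P : ℕ → Set p} → (∀ k → Dec (P k)) → ℕ → ℕ
largest P? zero = zero
largest P? (suc K) with P? (suc K)
... | yes _ = suc K
... | no  _ = largest P? K

-- The largest element of {0, 1/(n+1), 2/(n+1), …} whose square is at most x
-- (0 if x < 0).  The search bound suffices since x < (∣↥ x∣ + 1)².
approxSqrt : ℚ → ℕ → ℚ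
approxSqrt x n =
  grid n (largest (λ k → grid n k * grid n k ≤? x) (suc ℤ.∣ ↥ x ∣ ℕ.* suc n))

private
  grid≃ : ∀ n k → toℚᵘ (grid n k) ℚᵘ.≃ ℚᵘ.mkℚᵘ (+ k) n
  grid≃ n k = toℚᵘ-fromℚᵘ (ℚᵘ.mkℚᵘ (+ k) n)

  grid-mono : ∀ n {j k} → j ℕ.≤ k → grid n j ≤ grid n k
  grid-mono n {j} {k} j≤k = toℚᵘ-cancel-≤
    (ℚᵘ.≤-respˡ-≃ (ℚᵘ.≃-sym (grid≃ n j)) (ℚᵘ.≤-respʳ-≃ (ℚᵘ.≃-sym (grid≃ n k))
      (ℚᵘ.*≤* (ℤ.*-monoʳ-≤-nonNeg (+ suc n) (ℤ.+≤+ j≤k)))))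

  grid-suc : ∀ n k → grid n (suc k) ≡ grid n k + grid n 1
  grid-suc n k = toℚᵘ-injective (ℚᵘ.≃-trans (grid≃ n (suc k)) (ℚᵘ.≃-sym
    (ℚᵘ.≃-trans (toℚᵘ-homo-+ (grid n k) (grid n 1))
    (ℚᵘ.≃-trans (ℚᵘ.+-cong (grid≃ n k) (grid≃ n 1)) (ℚᵘ.*≡* eq)))))
    where
    eq : (+ k ℤ.* + suc n ℤ.+ + 1 ℤ.* + suc n) ℤ.* + suc n ≡ + suc k ℤ.* (+ suc n ℤ.* + suc n)
    eq = trans (cong (ℤ._* + suc n) (trans (sym (ℤ.*-distribʳ-+ (+ suc n) (+ k) (+ 1)))
                                           (cong (λ t → + t ℤ.* + suc n) (ℕ.+-comm k 1))))
               (ℤ.*-assoc (+ suc k) (+ suc n) (+ suc n))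

  grid≥0 : ∀ n k → 0ℚ ≤ grid n k
  grid≥0 n k = subst (_≤ grid n k) (0/n≡0 (suc n)) (grid-mono n {0} {k} ℕ.z≤n)

  grid-whole : ∀ n c → toℚᵘ (grid n (c ℕ.* suc n)) ℚᵘ.≃ ℚᵘ.mkℚᵘ (+ c) 0
  grid-whole n c = ℚᵘ.≃-trans (grid≃ n (c ℕ.* suc n))
    (ℚᵘ.*≡* (trans (ℤ.*-identityʳ (+ (c ℕ.* suc n))) (ℤ.pos-* c (suc n))))

  bound-sq : ∀ x n → let g = grid n (suc (suc ℤ.∣ ↥ x ∣ ℕ.* suc n)) in x < g * g
  bound-sq x@(mkℚ u d _) n = <-≤-trans x<g (≤-trans (≤-reflexive (sym (*-identityˡ g)))
                                      (*-monoʳ-≤-nonNeg g {{nonNegative 0≤g}} 1≤g))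
    where
    c = suc ℤ.∣ u ∣
    g = grid n (suc (c ℕ.* suc n))
    0≤g : 0ℚ ≤ g
    0≤g = grid≥0 n (suc (c ℕ.* suc n))
    c≤g : grid n (c ℕ.* suc n) ≤ g
    c≤g = grid-mono n (ℕ.n≤1+n (c ℕ.* suc n))
    1≤g : 1ℚ ≤ g
    1≤g = ≤-trans (toℚᵘ-cancel-≤ (ℚᵘ.≤-respʳ-≃ (ℚᵘ.≃-sym (grid-whole n c))
            (ℚᵘ.*≤* (ℤ.*-monoʳ-≤-nonNeg (+ 1) (ℤ.+≤+ {1} {c} (ℕ.s≤s ℕ.z≤n)))))) c≤g
    u<c : u ℤ.< + c
    u<c = i<1+∣i∣ u
      where
      i<1+∣i∣ : ∀ i → i ℤ.< + suc ℤ.∣ i ∣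
      i<1+∣i∣ (+ _)      = ℤ.+<+ ℕ.≤-refl
      i<1+∣i∣ ℤ.-[1+ _ ] = ℤ.-<+
    x<g : x < g
    x<g = <-≤-trans (toℚᵘ-cancel-< (ℚᵘ.<-respʳ-≃ (ℚᵘ.≃-sym (grid-whole n c))
            (ℚᵘ.*<* (ℤ.<-≤-trans
              (subst (ℤ._< + c) (sym (ℤ.*-identityʳ u)) u<c)
              (subst (ℤ._≤ + c ℤ.* + suc d) (ℤ.*-identityʳ (+ c))
                (ℤ.*-monoˡ-≤-nonNeg (+ c) (ℤ.+≤+ {1} {suc d} (ℕ.s≤s ℕ.z≤n)))))))) c≤g

  largest-yes : {P : ℕ → Set p} (P? : ∀ k → Dec (P k)) → ∀ K →
                largest P? K ≡ 0 ⊎ P (largest P? K)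
  largest-yes P? zero = inj₁ refl
  largest-yes P? (suc K) with P? (suc K)
  ... | yes pk = inj₂ pk
  ... | no  _  = largest-yes P? K

  largest-no : {P : ℕ → Set p} (P? : ∀ k → Dec (P k)) → ∀ K →
               ¬ P (suc K) → ¬ P (suc (largest P? K))
  largest-no P? zero    ¬p = ¬p
  largest-no P? (suc K) ¬p with P? (suc K)
  ... | yes _   = ¬p
  ... | no  ¬p′ = largest-no P? K ¬p′

approxSqrt≥0 : ∀ x n → 0ℚ ≤ approxSqrt x n
approxSqrt≥0 x n = grid≥0 n (largest (λ k → grid n k * grid n k ≤? x) (suc ℤ.∣ ↥ x ∣ ℕ.* suc n))

approxSqrt-lower : ∀ x n → approxSqrt x n ≡ 0ℚ ⊎ approxSqrt x n * approxSqrt x n ≤ x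
approxSqrt-lower x n = map₁ (λ eq → trans (cong (grid n) eq) (0/n≡0 (suc n)))
  (largest-yes (λ k → grid n k * grid n k ≤? x) (suc ℤ.∣ ↥ x ∣ ℕ.* suc n))

approxSqrt-upper : ∀ x n → let r = approxSqrt x n + grid n 1 in x < r * r
approxSqrt-upper x n =
  subst (λ r → x < r * r) (grid-suc n (largest P? K))
    (≰⇒> (largest-no P? K (<⇒≱ (bound-sq x n))))
  where
  P? = λ k → grid n k * grid n k ≤? x
  K  = suc ℤ.∣ ↥ x ∣ ℕ.* suc n
  <⇒≱ : ∀ {y z} → y < z → ¬ (z ≤ y)
  <⇒≱ y<z z≤y = <-irrefl refl (<-≤-trans y<z z≤y)

private
  grid-small : ∀ ε → 0ℚ < ε → ∃ λ N → ∀ n → N ℕ.≤ n → grid n 1 ≤ ε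
  grid-small ε@(mkℚ (+ suc u) d _) 0<ε = d , λ n d≤n → toℚᵘ-cancel-≤
    (ℚᵘ.≤-respˡ-≃ (ℚᵘ.≃-sym (grid≃ n 1)) (ℚᵘ.*≤*
      (ℤ.≤-trans (ℤ.≤-reflexive (ℤ.*-identityˡ (+ suc d)))
      (ℤ.≤-trans (ℤ.+≤+ (ℕ.s≤s d≤n))
      (ℤ.≤-trans (ℤ.≤-reflexive (sym (ℤ.*-identityˡ (+ suc n))))
        (ℤ.*-monoʳ-≤-nonNeg (+ suc n) (ℤ.+≤+ {1} {suc u} (ℕ.s≤s ℕ.z≤n))))))))
  grid-small (mkℚ (+ zero)  d _) (*<* (ℤ.+<+ ()))
  grid-small (mkℚ ℤ.-[1+ u ] d _) (*<* ())

  root-gap : ∀ {x y r s δ h} → 0ℚ ≤ s → 0ℚ ≤ δ → 0ℚ < h → δ ≤ h →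
             r ≡ 0ℚ ⊎ r * r ≤ x → y < (s + δ) * (s + δ) → x - y < h * h →
             r - s < h + h
  root-gap {x} {y} {r} {s} {δ} {h} 0≤s 0≤δ 0<h δ≤h low up near with r - s <? h + h
  ... | yes lt = lt
  ... | no ≮ = ⊥-elim (case low)
    where
    open +-*-Solver
    s+δ≥0 : 0ℚ ≤ s + δ
    s+δ≥0 = +-mono-≤ 0≤s 0≤δ
    s+2h≤r : (s + h) + h ≤ r
    s+2h≤r = subst₂ _≤_ (solve 2 (λ s h → (h :+ h) :+ s := (s :+ h) :+ h) refl s h)
                        (solve 2 (λ r s → (r :- s) :+ s := r) refl r s)
                        (+-monoˡ-≤ s (≮⇒≥ ≮))
    big : (s + δ) + h ≤ r
    big = ≤-trans (+-monoˡ-≤ h (+-monoʳ-≤ s δ≤h)) s+2h≤r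
    0<r : 0ℚ < r
    0<r = <-≤-trans (+-mono-≤-< s+δ≥0 0<h) big
    cross≥0 : 0ℚ ≤ (s + δ) * h + (s + δ) * h
    cross≥0 = +-mono-≤ nn nn
      where
      nn : 0ℚ ≤ (s + δ) * h
      nn = nonNegative⁻¹ ((s + δ) * h)
             {{nonNeg*nonNeg⇒nonNeg (s + δ) {{nonNegative s+δ≥0}} h {{nonNegative (<⇒≤ 0<h)}}}}
    case : ¬ (r ≡ 0ℚ ⊎ r * r ≤ x)
    case (inj₁ r≡0) = <-irrefl (sym r≡0) 0<r
    case (inj₂ r²≤x) = <-irrefl refl (<-≤-trans x<r² r²≤x)
      where
      x<r² : x < r * r
      x<r² = <-≤-trans
        (subst (_< h * h + (s + δ) * (s + δ)) (solve 2 (λ x y → (x :- y) :+ y := x) refl x y)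
          (+-mono-< near up))
        (≤-trans
          (subst₂ _≤_ (+-identityʳ _)
            (solve 2 (λ t h → (h :* h :+ t :* t) :+ (t :* h :+ t :* h) := (t :+ h) :* (t :+ h))
               refl (s + δ) h)
            (+-monoʳ-≤ (h * h + (s + δ) * (s + δ)) cross≥0))
          (sq-mono-≤ (+-mono-≤ s+δ≥0 (<⇒≤ 0<h)) big))

  root-cauchy : ∀ f r → IsCauchy f → (∀ n → 0ℚ ≤ r n) →
                (∀ n → r n ≡ 0ℚ ⊎ r n * r n ≤ f n) →
                (∀ n → f n < (r n + grid n 1) * (r n + grid n 1)) → IsCauchy r
  root-cauchy f r f-cauchy r≥0 lower upper ε 0<ε =
    conclude (half ε) (half>0 0<ε) (half+half ε)
    where
    conclude : ∀ h → 0ℚ < h → h + h ≡ ε →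
               ∃ λ N → ∀ m n → N ℕ.≤ m → N ℕ.≤ n → ∣ r m - r n ∣ < ε
    conclude h 0<h h+h≡ε = step (grid-small h 0<h) (f-cauchy (h * h)
      (positive⁻¹ (h * h) {{pos*pos⇒pos h {{positive 0<h}} h {{positive 0<h}}}}))
      where
      open +-*-Solver
      step : (∃ λ N → ∀ n → N ℕ.≤ n → grid n 1 ≤ h) →
             (∃ λ N → ∀ m n → N ℕ.≤ m → N ℕ.≤ n → ∣ f m - f n ∣ < h * h) →
             ∃ λ N → ∀ m n → N ℕ.≤ m → N ℕ.≤ n → ∣ r m - r n ∣ < ε
      step (M , δ≤h) (N , close) = M ℕ.⊔ N , λ m n ≤m ≤n →
        abs< (one m n ≤m ≤n)
             (subst (_< ε) (solve 2 (λ a b → b :- a := :- (a :- b)) refl (r m) (r n))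
               (one n m ≤n ≤m))
        where
        one : ∀ m n → M ℕ.⊔ N ℕ.≤ m → M ℕ.⊔ N ℕ.≤ n → r m - r n < ε
        one m n ≤m ≤n = subst (r m - r n <_) h+h≡ε
          (root-gap {x = f m} {y = f n} {r = r m} {s = r n} {δ = grid n 1} {h = h}
            (r≥0 n) (grid≥0 n 1) 0<h (δ≤h n (⊔-≤ˡ {M} {N} ≤n)) (lower m) (upper n)
            (≤-<-trans (x≤∣x∣ (f m - f n)) (close m n (⊔-≤ʳ {M} {N} ≤m) (⊔-≤ʳ {M} {N} ≤n))))

-- On negative reals the value of sqrt is 0; dist only applies it to sums of squares.
sqrt : ℝ → ℝ
sqrt x = mkℝ (λ n → approxSqrt (seq x n) n)
  (root-cauchy (seq x) (λ n → approxSqrt (seq x n) n) (cauchy x)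
    (λ n → approxSqrt≥0 (seq x n) n) (λ n → approxSqrt-lower (seq x n) n)
    (λ n → approxSqrt-upper (seq x n) n))

private
  square-close : ∀ {x r δ η B ε} → 0ℚ ≤ r → r ≤ B → 0ℚ < η → 0ℚ ≤ δ → δ ≤ η → δ ≤ 1ℚ →
                 (B + B) * η + 1ℚ * η ≡ ε → r * r ≤ x → x < (r + δ) * (r + δ) →
                 ∣ r * r - x ∣ < ε
  square-close {x} {r} {δ} {η} {B} {ε} 0≤r r≤B 0<η 0≤δ δ≤η δ≤1 η-eq r²≤x x<[r+δ]² =
    abs< (≤-<-trans r²-x≤0 0<ε) (subst (_< ε) (solve 2 (λ a b → b :- a := :- (a :- b)) refl (r * r) x) x-r²<ε)
    where
    open +-*-Solver
    x-r²<gap : x - r * r < ((r + r) + δ) * δ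
    x-r²<gap = subst (x - r * r <_)
      (solve 2 (λ r δ → (r :+ δ) :* (r :+ δ) :- r :* r := ((r :+ r) :+ δ) :* δ) refl r δ)
      (+-monoˡ-< (- (r * r)) x<[r+δ]²)
    2r+δ≥0 : 0ℚ ≤ (r + r) + δ
    2r+δ≥0 = +-mono-≤ (+-mono-≤ 0≤r 0≤r) 0≤δ
    gap≤ε : ((r + r) + δ) * δ ≤ ε
    gap≤ε = subst (((r + r) + δ) * δ ≤_)
      (trans (*-distribʳ-+ η (B + B) 1ℚ) η-eq)
      (≤-trans (*-monoˡ-≤-nonNeg ((r + r) + δ) {{nonNegative 2r+δ≥0}} δ≤η)
               (*-monoʳ-≤-nonNeg η {{nonNegative (<⇒≤ 0<η)}} (+-mono-≤ (+-mono-≤ r≤B r≤B) δ≤1)))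
    x-r²<ε : x - r * r < ε
    x-r²<ε = <-≤-trans x-r²<gap gap≤ε
    r²-x≤0 : r * r - x ≤ 0ℚ
    r²-x≤0 = subst (r * r - x ≤_) (+-inverseʳ x) (+-monoˡ-≤ (- x) r²≤x)
    0<ε : 0ℚ < ε
    0<ε = ≤-<-trans (subst (_≤ x - r * r) (+-inverseʳ (r * r)) (+-monoˡ-≤ (- (r * r)) r²≤x)) x-r²<ε

  root-square : (f r : ℕ → ℚ) → Bounded r → (∀ n → 0ℚ ≤ r n) → (∀ n → r n * r n ≤ f n) →
                (∀ n → f n < (r n + grid n 1) * (r n + grid n 1)) →
                ∀ ε → 0ℚ < ε → ∃ λ N → ∀ n → N ℕ.≤ n → ∣ r n * r n - f n ∣ < ε
  root-square f r (B , N₁ , 0<B , r≤B) r≥0 lower upper ε 0<ε =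
    step (scale (B + B) 1ℚ ε (+-mono-< 0<B 0<B) (positive⁻¹ 1ℚ) 0<ε)
    where
    step : (∃ λ η → 0ℚ < η × (B + B) * η + 1ℚ * η ≡ ε) →
           ∃ λ N → ∀ n → N ℕ.≤ n → ∣ r n * r n - f n ∣ < ε
    step (η , 0<η , η-eq) = conclude (grid-small η 0<η) (grid-small 1ℚ (positive⁻¹ 1ℚ))
      where
      conclude : (∃ λ N → ∀ n → N ℕ.≤ n → grid n 1 ≤ η) →
                 (∃ λ N → ∀ n → N ℕ.≤ n → grid n 1 ≤ 1ℚ) →
                 ∃ λ N → ∀ n → N ℕ.≤ n → ∣ r n * r n - f n ∣ < ε
      conclude (N₂ , δ≤η) (N₃ , δ≤1) = N₁ ℕ.⊔ (N₂ ℕ.⊔ N₃) , λ n ≤n →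
        let ≤n′ = ⊔-≤ʳ {N₁} {N₂ ℕ.⊔ N₃} ≤n
        in square-close {x = f n} {r = r n} {δ = grid n 1} {η = η} {B = B} {ε = ε}
             (r≥0 n) (≤-trans (x≤∣x∣ (r n)) (r≤B n (⊔-≤ˡ {N₁} {N₂ ℕ.⊔ N₃} ≤n))) 0<η (grid≥0 n 1)
             (δ≤η n (⊔-≤ˡ {N₂} {N₃} ≤n′)) (δ≤1 n (⊔-≤ʳ {N₂} {N₃} ≤n′)) η-eq (lower n) (upper n)

sqrt-square : ∀ x → (∀ n → 0ℚ ≤ seq x n) → sqrt x *ℝ sqrt x ≈ x
sqrt-square x x≥0 = root-square (seq x) (λ n → approxSqrt (seq x n) n)
  (eventuallyBounded (sqrt x)) (λ n → approxSqrt≥0 (seq x n) n)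
  (λ n → lower n (approxSqrt-lower (seq x n) n)) (λ n → approxSqrt-upper (seq x n) n)
  where
  lower : ∀ n → approxSqrt (seq x n) n ≡ 0ℚ ⊎ approxSqrt (seq x n) n * approxSqrt (seq x n) n ≤ seq x n →
          approxSqrt (seq x n) n * approxSqrt (seq x n) n ≤ seq x n
  lower n (inj₁ r≡0) = ≤-trans (≤-reflexive (trans (cong₂ _*_ r≡0 r≡0) (*-zeroˡ 0ℚ))) (x≥0 n)
  lower n (inj₂ le)  = le

Point : ℕ → Set
Point n = Vector ℝ n

Point-setoid : ℕ → Setoid 0ℓ 0ℓ
Point-setoid = Pointwise.≋-setoid ℝ-setoid

infix 4 _≋_
_≋_ : ∀ {n} → Point n → Point n → Set
_≋_ = Pointwise._≋_ ℝ-setoid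

dist : ∀ {n} → Point n → Point n → ℝ
dist x y = sqrt (foldr _+ℝ_ 0ℝ (λ i → (x i -ℝ y i) *ℝ (x i -ℝ y i)))

Distances : ∀ {n} → Pred (Point n) p → Pred ℝ p
Distances G δ = ∃₂ λ x y → x ∈ G × y ∈ G × ¬ (x ≋ y) × δ ≈ dist x y

Box : ∀ {n} → (Fin n → Pred ℝ p) → Pred (Point n) p
Box A x = ∀ i → x i ∈ A i

-- The monomial x₁^α₁ ⋯ xₙ^αₙ is represented by its exponent vector (α₁, …, αₙ).
Monomial : ℕ → Set
Monomial n = Vec ℕ n

BoundedMonomials : (n q s : ℕ) → Pred (Monomial n) 0ℓ
BoundedMonomials n q s α = (∀ i → Vec.lookup α i ℕ.≤ q ℕ.∸ 1) × Vec.sum α ℕ.≤ s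

{-# OPTIONS --safe #-}
module Submission where

-- Let p₁, …, pₘ be distinct points of F and D₁, …, Dₜ (t ≤ s) the squared
-- distances between them.  Suppose v ∈ ℝᵐ is orthogonal to every reduced monomial
-- of degree at most s evaluated at the points.  On the box a power x_c^q is a
-- combination of lower powers of x_c, so v is orthogonal to all monomials of
-- degree at most s.  The polynomial P(x, y) = ∏ₗ (Dₗ - |x - y|²) has degree at
-- most 2s, so each of its monomials x^α y^β has |α| ≤ s or |β| ≤ s, whence
-- Σᵢⱼ vᵢ vⱼ P(pᵢ, pⱼ) = 0.  But P(pᵢ, pⱼ) vanishes for i ≠ j and equals ∏ₗ Dₗ ≠ 0
-- for i = j, so Σᵢ vᵢ² = 0 and v = 0.  Evaluation of the reduced monomials thus has
-- trivial kernel, and m is at most their number N, which even improves on 2N.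
--
-- Constructively, x ≈ 0 is ¬¬-stable for Cauchy reals, which together with the
-- decidability of m ≤ N licenses the classical case distinctions.

open import Defs renaming (_≈_ to _≈ℝ_)
open import Algebra.Bundles using (CommutativeRing)
import Algebra.Properties.Ring as RingProperties
import Algebra.Properties.Semiring.Exp as Exp
import Algebra.Properties.Semiring.Sum as Sum
import Algebra.Solver.Ring.NaturalCoefficients.Default as SemiringSolver
open import Data.Empty using (⊥-elim)
open import Data.Fin.Base using (Fin; zero; suc; punchIn; punchOut)
import Data.Fin.Properties as Fin
import Data.Integer.Base as ℤ
open import Data.Nat.Base as ℕ using (ℕ; _≤_; zero; suc; z≤n; s≤s)
import Data.Nat.Properties as ℕ
open import Data.Product.Base using (∃; ∃₂; _×_; _,_; proj₁; proj₂)
import Data.Rational.Base as ℚ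
import Data.Rational.Properties as ℚ
import Data.Rational.Solver as ℚSolver
open import Data.Sum.Base using (inj₁; inj₂)
open import Data.Vec.Base as Vec using ([]; _∷_)
import Data.Vec.Properties as Vec
open import Data.Vec.Functional as Vector using (Vector; foldr)
open import Function.Base using (_∘_)
open import Function.Bundles using (Bijection; Injection)
open import Level using (Level; 0ℓ; _⊔_) renaming (suc to lsuc)
open import Relation.Binary.Bundles using (Setoid)
open import Relation.Binary.PropositionalEquality as ≡ using (_≡_; _≢_; setoid)
import Relation.Binary.Reasoning.Setoid as SetoidReasoning
open import Relation.Nullary using (¬_; yes; no)
open import Relation.Nullary.Decidable using (decidable-stable)
open import Relation.Unary using (Pred; _⊆_)

-- Collects the facts about ℝ on which the algebra rests, and so keeps Cauchy sequences out of the
-- polynomial argument. Stability of `x ≈ 0#` takes the place of a decision procedure for it.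
record FormallyRealDomain c ℓ : Set (lsuc (c ⊔ ℓ)) where
  field
    commutativeRing : CommutativeRing c ℓ

  open CommutativeRing commutativeRing public hiding (zero)

  field
    ≈0-stable    : ∀ x → ¬ ¬ x ≈ 0# → x ≈ 0#
    *-cancel-0   : ∀ x y → ¬ x ≈ 0# → x * y ≈ 0# → y ≈ 0#
    1≉0          : ¬ 1# ≈ 0#
    squares-sum0 : ∀ {n} (v : Vector Carrier n) →
                   foldr _+_ 0# (λ i → v i * v i) ≈ 0# → ∀ i → v i ≈ 0#

-- Linear algebra over a formally real domain.

module LinearAlgebra {c ℓ} (K : FormallyRealDomain c ℓ) where

  open FormallyRealDomain K
  open RingProperties ring using (-‿distribˡ-*; -0#≈0#)
  open Sum semiring using (sum; sum-cong-≋; sum-replicate-zero; ∑-distrib-+; *-distribˡ-sum)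
  open SemiringSolver commutativeSemiring using (solve; _:=_; _:+_; _:*_)
  open SetoidReasoning (CommutativeRing.setoid commutativeRing)

  sum-zero : ∀ {m} (f : Vector Carrier m) → (∀ i → f i ≈ 0#) → sum f ≈ 0#
  sum-zero {m} f f≈0 = begin
    sum f                         ≈⟨ sum-cong-≋ f≈0 ⟩
    sum (Vector.replicate m 0#)   ≈⟨ sum-replicate-zero m ⟩
    0#                            ∎

  sum-single : ∀ {m} (f : Vector Carrier m) i → (∀ j → i ≢ j → f j ≈ 0#) → sum f ≈ f i
  sum-single f zero    f≈0 = begin
    f zero + sum (f ∘ suc)  ≈⟨ +-congˡ (sum-zero (f ∘ suc) (λ j → f≈0 (suc j) λ ())) ⟩
    f zero + 0#             ≈⟨ +-identityʳ _ ⟩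
    f zero                  ∎
  sum-single f (suc i) f≈0 = begin
    f zero + sum (f ∘ suc)
      ≈⟨ +-cong (f≈0 zero λ ())
                (sum-single (f ∘ suc) i (λ j i≢j → f≈0 (suc j) (i≢j ∘ Fin.suc-injective))) ⟩
    0# + f (suc i)
      ≈⟨ +-identityˡ _ ⟩
    f (suc i) ∎

  infix 8 _·_
  -- Opaque so that its arguments can be inferred without inverting foldr.
  opaque
    _·_ : ∀ {m} → Vector Carrier m → Vector Carrier m → Carrier
    u · f = sum (λ i → u i * f i)

    ·-sum : ∀ {m} (u f : Vector Carrier m) → u · f ≈ sum (λ i → u i * f i)
    ·-sum u f = refl

    ·-congˡ : ∀ {m} (u : Vector Carrier m) {f g} → (∀ i → f i ≈ g i) → u · f ≈ u · g
    ·-congˡ u f≈g = sum-cong-≋ (λ i → *-congˡ (f≈g i))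

    ·-distribˡ-+ : ∀ {m} (u f g : Vector Carrier m) → u · (λ i → f i + g i) ≈ u · f + u · g
    ·-distribˡ-+ u f g = begin
      sum (λ i → u i * (f i + g i))                ≈⟨ sum-cong-≋ (λ i → distribˡ (u i) (f i) (g i)) ⟩
      sum (λ i → u i * f i + u i * g i)            ≈⟨ ∑-distrib-+ (λ i → u i * f i) (λ i → u i * g i) ⟩
      sum (λ i → u i * f i) + sum (λ i → u i * g i) ∎

    ·-scaleʳ : ∀ {m} a (u f : Vector Carrier m) → u · (λ i → a * f i) ≈ a * u · f
    ·-scaleʳ a u f = begin
      sum (λ i → u i * (a * f i))
        ≈⟨ sum-cong-≋ (λ i → solve 3 (λ a x y → x :* (a :* y) := a :* (x :* y)) refl a (u i) (f i)) ⟩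
      sum (λ i → a * (u i * f i))
        ≈⟨ *-distribˡ-sum a (λ i → u i * f i) ⟨
      a * sum (λ i → u i * f i) ∎

    ·-scaleˡ : ∀ {m} a (u f : Vector Carrier m) → (λ i → a * u i) · f ≈ a * u · f
    ·-scaleˡ a u f = begin
      sum (λ i → (a * u i) * f i)  ≈⟨ sum-cong-≋ (λ i → *-assoc a (u i) (f i)) ⟩
      sum (λ i → a * (u i * f i))  ≈⟨ *-distribˡ-sum a (λ i → u i * f i) ⟨
      a * sum (λ i → u i * f i)    ∎

    ·-zeroʳ : ∀ {m} (u f : Vector Carrier m) → (∀ i → f i ≈ 0#) → u · f ≈ 0#
    ·-zeroʳ u f f≈0 = sum-zero _ (λ i → trans (*-congˡ (f≈0 i)) (zeroʳ (u i)))

    ·-unfold : ∀ {m} (u f : Vector Carrier (suc m)) →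
               u · f ≈ u zero * f zero + (u ∘ suc) · (f ∘ suc)
    ·-unfold u f = refl

  +-0 : ∀ {x y} → x ≈ 0# → y ≈ 0# → x + y ≈ 0#
  +-0 x≈0 y≈0 = trans (+-cong x≈0 y≈0) (+-identityˡ 0#)

  *-0ʳ : ∀ x {y} → y ≈ 0# → x * y ≈ 0#
  *-0ʳ x y≈0 = trans (*-congˡ y≈0) (zeroʳ x)

  -- Fraction-free Gaussian elimination on the first column.
  trivialKernel⇒≤ : ∀ {k m} (M : Fin k → Vector Carrier m) →
                    (∀ v → (∀ i → v · M i ≈ 0#) → ∀ j → v j ≈ 0#) → m ≤ k
  trivialKernel⇒≤ {m = zero} M ker = z≤n
  -- Without rows every vector lies in the kernel, in particular the constant vector 1.
  trivialKernel⇒≤ {k = zero} {m = suc m} M ker = ⊥-elim (1≉0 (ker (λ _ → 1#) (λ ()) zero))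
  trivialKernel⇒≤ {k = suc k} {m = suc m} M ker with m ℕ.≤? k
  ... | yes m≤k = s≤s m≤k
  -- A nonzero entry in the first column would give m ≤ k by elimination, so by stability that
  -- column vanishes. Then the unit vector `e` lies in the kernel, which forces 1 ≈ 0.
  ... | no  m≰k = ⊥-elim (1≉0 (ker e (λ i → trans (·-sum e (M i)) (+-0 (trans (*-identityˡ _) (column≈0 i))
                                               (sum-zero _ (λ j → zeroˡ (M i (suc j)))))) zero))
    where
    e : Vector Carrier (suc m)
    e zero    = 1#
    e (suc _) = 0#

    eliminate : ∀ i → ¬ M i zero ≈ 0# → m ≤ k
    eliminate i pivot≉0 = trivialKernel⇒≤ (λ r → reduced (punchIn i r)) kernel
      where
      pivot : Carrier
      pivot = M i zero

      -- Row s times the pivot, minus `M s zero` times row i. This cancels the first entry without a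
      -- division, so only the other entries are kept.
      reduced : Fin (suc k) → Vector Carrier m
      reduced s j = pivot * M s (suc j) + (- M s zero) * M i (suc j)

      kernel : ∀ w → (∀ r → w · reduced (punchIn i r) ≈ 0#) → ∀ j → w j ≈ 0#
      kernel w w-ker j = *-cancel-0 pivot (w j) pivot≉0 (ker v v-ker (suc j))
        where
        -- The lift of `w` that solves row i: the product with row i is (- X) * pivot + pivot * X
        -- for X = `w · (M i ∘ suc)`. Scaling the remaining entries by the pivot avoids dividing by
        -- it; `*-cancel-0` removes the factor afterwards.
        v : Vector Carrier (suc m)
        v zero    = - (w · (M i ∘ suc))
        v (suc j) = pivot * w j

        row : ∀ s → v · M s ≈ w · reduced s
        row s = begin
          v · M s
            ≈⟨ ·-unfold v (M s) ⟩
          (- X) * M s zero + (λ j → pivot * w j) · (M s ∘ suc)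
            ≈⟨ +-cong neg (·-scaleˡ pivot w (M s ∘ suc)) ⟩
          (- M s zero) * X + pivot * w · (M s ∘ suc)
            ≈⟨ +-comm _ _ ⟩
          pivot * w · (M s ∘ suc) + (- M s zero) * X
            ≈⟨ +-cong (·-scaleʳ pivot w (M s ∘ suc)) (·-scaleʳ (- M s zero) w (M i ∘ suc)) ⟨
          w · (λ j → pivot * M s (suc j)) + w · (λ j → (- M s zero) * M i (suc j))
            ≈⟨ ·-distribˡ-+ w _ _ ⟨
          w · reduced s ∎
          where
          X : Carrier
          X = w · (M i ∘ suc)
          neg : (- X) * M s zero ≈ (- M s zero) * X
          neg = trans (sym (-‿distribˡ-* X (M s zero)))
               (trans (-‿cong (*-comm X (M s zero))) (-‿distribˡ-* (M s zero) X))

        v-ker : ∀ s → v · M s ≈ 0#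
        v-ker s with i Fin.≟ s
        ... | yes ≡.refl = trans (row i) (·-zeroʳ w _ (λ j →
                trans (+-congˡ (sym (-‿distribˡ-* pivot (M i (suc j))))) (-‿inverseʳ _)))
        ... | no  i≢s = trans (row s)
                (≡.subst (λ s → w · reduced s ≈ 0#) (Fin.punchIn-punchOut i≢s) (w-ker (punchOut i≢s)))

    column≈0 : ∀ i → M i zero ≈ 0#
    column≈0 i = ≈0-stable _ (λ pivot≉0 → m≰k (eliminate i pivot≉0))

  -- Serves twice: with the q elements of a side of the box as roots it vanishes on a coordinate of
  -- every point, and with the squared distances as roots it gives P(x, y).
  nodal : ∀ {k} → Vector Carrier k → Carrier → Carrier
  nodal {zero}  a y = 1#
  nodal {suc k} a y = (a zero - y) * nodal (a ∘ suc) y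

  nodal-cong : ∀ {k} (a : Vector Carrier k) {x y} → x ≈ y → nodal a x ≈ nodal a y
  nodal-cong {zero}  a x≈y = refl
  nodal-cong {suc k} a x≈y = *-cong (+-congˡ (-‿cong x≈y)) (nodal-cong (a ∘ suc) x≈y)

  nodal-root : ∀ {k} (a : Vector Carrier k) l {y} → y ≈ a l → nodal a y ≈ 0#
  nodal-root a zero    {y} y≈a = trans (*-congʳ (trans (+-congˡ (-‿cong y≈a)) (-‿inverseʳ (a zero)))) (zeroˡ _)
  nodal-root a (suc l) {y} y≈a = *-0ʳ _ (nodal-root (a ∘ suc) l y≈a)

  nodal-0≉0 : ∀ {k} (a : Vector Carrier k) → (∀ l → ¬ a l ≈ 0#) → ¬ nodal a 0# ≈ 0#
  nodal-0≉0 {zero}  a a≉0 = 1≉0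
  nodal-0≉0 {suc k} a a≉0 = nodal-0≉0 (a ∘ suc) (a≉0 ∘ suc) ∘ *-cancel-0 _ _
    (λ a-0≈0 → a≉0 zero (trans (sym (trans (+-congˡ -0#≈0#) (+-identityʳ _))) a-0≈0))

-- Monomials and the reduction of their exponents on the box.

module Polynomials {c ℓ} (K : FormallyRealDomain c ℓ) where

  open FormallyRealDomain K
  open LinearAlgebra K
  open RingProperties ring using (-‿distribˡ-*; -‿distribʳ-*; -1*x≈-x; -‿involutive; -0#≈0#)
  open Exp semiring using (_^_; ^-homo-*)
  open Sum semiring using (sum; *-distribʳ-sum)
  open SemiringSolver commutativeSemiring using (solve; _:=_; _:+_; _:*_; con)
  open SetoidReasoning (CommutativeRing.setoid commutativeRing)

  eval : ∀ {n} → Monomial n → Vector Carrier n → Carrier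
  eval []      x = 1#
  eval (k ∷ α) x = x zero ^ k * eval α (x ∘ suc)

  raise : ∀ {n} → Fin n → ℕ → Monomial n → Monomial n
  raise c k α = Vec.updateAt α c (k ℕ.+_)

  eval-raise : ∀ {n} c k (α : Monomial n) x → eval (raise c k α) x ≈ x c ^ k * eval α x
  eval-raise zero    k (j ∷ α) x =
    trans (*-congʳ (^-homo-* (x zero) k j)) (*-assoc (x zero ^ k) (x zero ^ j) _)
  eval-raise (suc c) k (j ∷ α) x = trans (*-congˡ (eval-raise c k α (x ∘ suc)))
    (solve 3 (λ a b d → a :* (b :* d) := b :* (a :* d)) refl (x zero ^ j) (x (suc c) ^ k) _)

  sum-raise : ∀ {n} c k (α : Monomial n) → Vec.sum (raise c k α) ≡ k ℕ.+ Vec.sum α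
  sum-raise zero    k (j ∷ α) = ℕ.+-assoc k j (Vec.sum α)
  sum-raise (suc c) k (j ∷ α) = ≡.trans (≡.cong (j ℕ.+_) (sum-raise c k α))
    (≡.trans (≡.sym (ℕ.+-assoc j k _))
    (≡.trans (≡.cong (ℕ._+ Vec.sum α) (ℕ.+-comm j k)) (ℕ.+-assoc k j _)))

  eval-1 : ∀ {n} (x : Vector Carrier n) → eval (Vec.replicate n 0) x ≈ 1#
  eval-1 {zero}  x = refl
  eval-1 {suc n} x = trans (*-identityˡ _) (eval-1 (x ∘ suc))

  sum-1 : ∀ n → Vec.sum (Vec.replicate n 0) ≡ 0
  sum-1 zero    = ≡.refl
  sum-1 (suc n) = sum-1 n

  -- Up to sign, nodal a (ξ i) is ξ i ^ k plus lower powers.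
  ·-^-reduce : ∀ {m k} (v ξ φ : Vector Carrier m) (a : Vector Carrier k) →
               (∀ j → j ℕ.< k → v · (λ i → ξ i ^ j * φ i) ≈ 0#) →
               v · (λ i → nodal a (ξ i) * φ i) ≈ 0# →
               v · (λ i → ξ i ^ k * φ i) ≈ 0#
  ·-^-reduce {k = zero}  v ξ φ a low top = top
  ·-^-reduce {k = suc k} v ξ φ a low top = begin
      v · (λ i → ξ i ^ suc k * φ i)
        ≈⟨ -‿involutive _ ⟨
      - - (v · (λ i → ξ i ^ suc k * φ i))
        ≈⟨ -‿cong (begin
             - (v · (λ i → ξ i ^ suc k * φ i))            ≈⟨ -1*x≈-x _ ⟨
             (- 1#) * v · (λ i → ξ i ^ suc k * φ i)       ≈⟨ +-identityˡ _ ⟨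
             0# + (- 1#) * v · (λ i → ξ i ^ suc k * φ i)  ≈⟨ +-congʳ (*-0ʳ (a zero) (low k ℕ.≤-refl)) ⟨
             a zero * v · (λ i → ξ i ^ k * φ i) + (- 1#) * v · (λ i → ξ i ^ suc k * φ i)
                                                          ≈⟨ split k ⟨
             v · (λ i → ξ i ^ k * ψ i)                    ≈⟨ v·ξᵏψ≈0 ⟩
             0#                                           ∎) ⟩
      - 0#
        ≈⟨ -0#≈0# ⟩
      0# ∎
    where
    -- Absorbing one nodal factor into the weight lowers k. By `split`, the j-th moment of ψ
    -- combines the j-th and (j+1)-th moments of φ; for j = k the first of these is zero by `low`,
    -- leaving -1 times the moment sought.
    ψ : Vector Carrier _
    ψ i = (a zero - ξ i) * φ i

    split : ∀ j → v · (λ i → ξ i ^ j * ψ i) ≈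
                  a zero * v · (λ i → ξ i ^ j * φ i) + (- 1#) * v · (λ i → ξ i ^ suc j * φ i)
    split j = begin
      v · (λ i → ξ i ^ j * ψ i)
        ≈⟨ ·-congˡ v (λ i → trans (*-congˡ (*-congʳ (+-congˡ (sym (-1*x≈-x (ξ i))))))
             (solve 5 (λ y f a n x → y :* ((a :+ n :* x) :* f) := a :* (y :* f) :+ n :* ((x :* y) :* f))
                refl (ξ i ^ j) (φ i) (a zero) (- 1#) (ξ i))) ⟩
      v · (λ i → a zero * (ξ i ^ j * φ i) + (- 1#) * (ξ i ^ suc j * φ i))
        ≈⟨ ·-distribˡ-+ v _ _ ⟩
      v · (λ i → a zero * (ξ i ^ j * φ i)) + v · (λ i → (- 1#) * (ξ i ^ suc j * φ i))
        ≈⟨ +-cong (·-scaleʳ (a zero) v _) (·-scaleʳ (- 1#) v _) ⟩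
      a zero * v · (λ i → ξ i ^ j * φ i) + (- 1#) * v · (λ i → ξ i ^ suc j * φ i) ∎

    v·ξᵏψ≈0 : v · (λ i → ξ i ^ k * ψ i) ≈ 0#
    v·ξᵏψ≈0 = ·-^-reduce v ξ ψ (a ∘ suc)
      -- Here j and j + 1 are both below k + 1, so `low` covers both moments.
      (λ j j<k → trans (split j)
        (+-0 (*-0ʳ _ (low j (ℕ.m≤n⇒m≤1+n j<k))) (*-0ʳ _ (low (suc j) (s≤s j<k)))))
      (trans (·-congˡ v (λ i → solve 3 (λ w u f → w :* (u :* f) := (u :* w) :* f) refl
                (nodal (a ∘ suc) (ξ i)) (a zero - ξ i) (φ i))) top)

  -- Induction on the degree. If the exponent at c is at least q, factor x^α as x_c^q x^β. The nodal
  -- polynomial of `a c` vanishes at the c-th coordinate of every point, so `·-^-reduce` leaves the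
  -- monomials x_c^j x^β with j < q, whose degree is smaller.
  annihilates-bounded⇒all :
    ∀ {m n q s} (p : Fin m → Vector Carrier n) (a : Fin n → Vector Carrier q) →
    (∀ i c → ∃ λ l → p i c ≈ a c l) → ∀ v →
    (∀ α → BoundedMonomials n q s α → v · (eval α ∘ p) ≈ 0#) →
    ∀ α → Vec.sum α ≤ s → v · (eval α ∘ p) ≈ 0#
  annihilates-bounded⇒all {m} {n} {q} {s} p a p∈a v bounded α ∣α∣≤s =
    go (suc (Vec.sum α)) α ℕ.≤-refl ∣α∣≤s
    where
    -- The recursion is on `d`, a strict upper bound for the degree.
    go : ∀ d α → Vec.sum α ℕ.< d → Vec.sum α ≤ s → v · (eval α ∘ p) ≈ 0#
    go (suc d) α (s≤s ∣α∣≤d) ∣α∣≤s with Fin.all? (λ c → Vec.lookup α c ℕ.≤? q ℕ.∸ 1)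
    ... | yes α≤q-1 = bounded α (α≤q-1 , ∣α∣≤s)
    ... | no  α≰q-1 with Fin.¬∀⟶∃¬ n _ (λ c → Vec.lookup α c ℕ.≤? q ℕ.∸ 1) α≰q-1
    ... | c , αc≰q-1 = ≡.subst (λ α → v · (eval α ∘ p) ≈ 0#) raised
        (trans (·-congˡ v (λ i → eval-raise c q β (p i)))
          (·-^-reduce v (λ i → p i c) (eval β ∘ p) (a c)
            (λ j j<q → trans (·-congˡ v (λ i → sym (eval-raise c j β (p i))))
              (go d (raise c j β) (ℕ.<-≤-trans (smaller j<q) ∣α∣≤d)
                                  (ℕ.≤-trans (ℕ.<⇒≤ (smaller j<q)) ∣α∣≤s)))
            (·-zeroʳ v _ (λ i → trans (*-congʳ (nodal-root (a c) _ (proj₂ (p∈a i c)))) (zeroˡ _)))))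
      where
      β : Monomial n
      β = Vec.updateAt α c (ℕ._∸ q)
      q≤αc : q ≤ Vec.lookup α c
      q≤αc = ℕ.≤-trans (ℕ.m≤n+m∸n q 1) (ℕ.≰⇒> αc≰q-1)
      raised : raise c q β ≡ α
      raised = ≡.trans (Vec.updateAt-updateAt-local c {h = λ k → q ℕ.+ (k ℕ.∸ q)} α ≡.refl)
                       (Vec.updateAt-id-local c α (ℕ.m+[n∸m]≡n q≤αc))
      smaller : ∀ {j} → j ℕ.< q → Vec.sum (raise c j β) ℕ.< Vec.sum α
      smaller {j} j<q = ≡.subst₂ ℕ._<_ (≡.sym (sum-raise c j β))
        (≡.trans (≡.sym (sum-raise c q β)) (≡.cong Vec.sum raised)) (ℕ.+-monoˡ-< (Vec.sum β) j<q)

  -- The quadratic form of the distance polynomial.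

  sqDist : ∀ {n} → Vector Carrier n → Vector Carrier n → Carrier
  sqDist x y = sum (λ c → (x c - y c) * (x c - y c))

  sqDist-refl : ∀ {n} (x : Vector Carrier n) → sqDist x x ≈ 0#
  sqDist-refl x = sum-zero _ (λ c → *-0ʳ _ (-‿inverseʳ (x c)))

  -- The value vᵀGv of the quadratic form with matrix `G`.
  form : ∀ {m} → Vector Carrier m → (Fin m → Fin m → Carrier) → Carrier
  form v G = v · (λ i → v · G i)

  form-cong : ∀ {m} (v : Vector Carrier m) {G H} → (∀ i j → G i j ≈ H i j) → form v G ≈ form v H
  form-cong v G≈H = ·-congˡ v (λ i → ·-congˡ v (G≈H i))

  form-+ : ∀ {m} (v : Vector Carrier m) {G H} → form v G ≈ 0# → form v H ≈ 0# →
           form v (λ i j → G i j + H i j) ≈ 0#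
  form-+ v {G} {H} G-0 H-0 = trans (·-congˡ v (λ i → ·-distribˡ-+ v (G i) (H i)))
    (trans (·-distribˡ-+ v _ _) (+-0 G-0 H-0))

  form-* : ∀ {m} (v : Vector Carrier m) a {G} → form v G ≈ 0# → form v (λ i j → a * G i j) ≈ 0#
  form-* v a {G} G-0 = trans (·-congˡ v (λ i → ·-scaleʳ a v (G i)))
    (trans (·-scaleʳ a v _) (*-0ʳ a G-0))

  form-sum : ∀ {m n} (v : Vector Carrier m) (G : Fin n → Fin m → Fin m → Carrier) →
             (∀ c → form v (G c) ≈ 0#) → form v (λ i j → sum (λ c → G c i j)) ≈ 0#
  form-sum {n = zero}  v G G-0 = ·-zeroʳ v _ (λ i → ·-zeroʳ v _ (λ j → refl))
  form-sum {n = suc n} v G G-0 = form-+ v (G-0 zero) (form-sum v (G ∘ suc) (G-0 ∘ suc))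

  -- A matrix of rank one has a form that factors, so it suffices that `v` annihilates one of the
  -- two vectors.
  form-⊗ : ∀ {m} (v f g : Vector Carrier m) → form v (λ i j → f i * g j) ≈ v · f * v · g
  form-⊗ v f g = trans (·-congˡ v (λ i → ·-scaleʳ (f i) v g))
    (trans (·-congˡ v (λ i → *-comm (f i) (v · g)))
    (trans (·-scaleʳ (v · g) v f) (*-comm _ _)))

  -- Every summand is a constant times a product of coordinates, so multiplying x^α y^β by it only
  -- raises exponents.
  square-expand : ∀ x y → (x - y) * (x - y) ≈ (x * x + y * y) + (- (1# + 1#)) * (x * y)
  square-expand x y = begin
    (x + - y) * (x + - y)
      ≈⟨ solve 2 (λ x n → (x :+ n) :* (x :+ n) := (x :* x :+ n :* n) :+ (x :* n :+ x :* n)) refl x (- y) ⟩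
    (x * x + (- y) * (- y)) + (x * - y + x * - y)
      ≈⟨ +-cong (+-congˡ (trans (sym (-‿distribˡ-* y (- y)))
                         (trans (-‿cong (sym (-‿distribʳ-* y y))) (-‿involutive _))))
                (trans (+-cong (sym (-‿distribʳ-* x y)) (sym (-‿distribʳ-* x y)))
                (trans (solve 1 (λ z → z :+ z := (con 1 :+ con 1) :* z) refl (- (x * y)))
                (trans (sym (-‿distribʳ-* (1# + 1#) (x * y))) (-‿distribˡ-* (1# + 1#) (x * y))))) ⟩
    (x * x + y * y) + (- (1# + 1#)) * (x * y) ∎

  -- Expanding the product, each term is x^α y^β with |α| + |β| ≤ 2s, so one of
  -- the two factors has degree at most s and is annihilated by v.
  form-nodal : ∀ {m n s} (p : Fin m → Vector Carrier n) v →
               (∀ α → Vec.sum α ≤ s → v · (eval α ∘ p) ≈ 0#) →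
               ∀ {t} (D : Vector Carrier t) α β → (Vec.sum α ℕ.+ Vec.sum β) ℕ.+ (t ℕ.+ t) ≤ s ℕ.+ s →
               form v (λ i j → (eval α (p i) * eval β (p j)) * nodal D (sqDist (p i) (p j))) ≈ 0#
  form-nodal {s = s} p v ann {zero} D α β deg =
    trans (form-cong v (λ i j → *-identityʳ _)) (trans (form-⊗ v (eval α ∘ p) (eval β ∘ p)) product)
    where
    product : v · (eval α ∘ p) * v · (eval β ∘ p) ≈ 0#
    product with Vec.sum α ℕ.≤? s
    ... | yes ∣α∣≤s = trans (*-congʳ (ann α ∣α∣≤s)) (zeroˡ _)
    ... | no  ∣α∣≰s = *-0ʳ _ (ann β (ℕ.≮⇒≥ λ s<∣β∣ → ℕ.<⇒≱
            (ℕ.+-mono-< (ℕ.≰⇒> ∣α∣≰s) s<∣β∣)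
            (≡.subst (ℕ._≤ s ℕ.+ s) (ℕ.+-identityʳ _) deg)))
  form-nodal {m} {n} {s} p v ann {suc t} D α β deg = trans
    (form-cong v (λ i j → expand (eval α (p i)) (eval β (p j)) (p i) (p j) (W i j)))
    -- The first factor is `D zero` minus a sum over the coordinates. Coordinate c contributes terms
    -- with x_c², y_c² and x_c y_c, each of which has the shape treated by `IH` after raising
    -- exponents.
    (form-+ v (form-* v (D zero) (IH α β deg₀))
              (form-* v (- 1#) (form-sum v (λ c i j → sq (p i) (p j) c * T i j) (λ c → trans
                (form-cong v (λ i j → term c i j))
                (form-+ v (form-+ v (IH (up c (up c α)) β (deg₂ c)) (IH α (up c (up c β)) (deg₃ c)))
                          (form-* v (- (1# + 1#)) (IH (up c α) (up c β) (deg₁ c))))))))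
    where
    W T : Fin m → Fin m → Carrier
    W i j = nodal (D ∘ suc) (sqDist (p i) (p j))
    T i j = (eval α (p i) * eval β (p j)) * W i j

    sq : Vector Carrier n → Vector Carrier n → Vector Carrier n
    sq x y c = (x c - y c) * (x c - y c)

    up : Fin n → Monomial n → Monomial n
    up c = raise c 1

    eval-up : ∀ c α x → eval (up c α) x ≈ x c * eval α x
    eval-up c α x = trans (eval-raise c 1 α x) (*-congʳ (*-identityʳ _))

    eval-up² : ∀ c α x → eval (up c (up c α)) x ≈ x c * (x c * eval α x)
    eval-up² c α x = trans (eval-up c (up c α) x) (*-congˡ (eval-up c α x))

    IH : ∀ α β → (Vec.sum α ℕ.+ Vec.sum β) ℕ.+ (t ℕ.+ t) ≤ s ℕ.+ s →
         form v (λ i j → (eval α (p i) * eval β (p j)) * W i j) ≈ 0#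
    IH = form-nodal p v ann (D ∘ suc)

    -- Removing one factor frees two degrees, exactly what the raised exponents in `deg₁`, `deg₂`
    -- and `deg₃` consume.
    deg-2 : suc (suc ((Vec.sum α ℕ.+ Vec.sum β) ℕ.+ (t ℕ.+ t))) ≤ s ℕ.+ s
    deg-2 = ≡.subst (ℕ._≤ s ℕ.+ s) (≡.trans (ℕ.+-suc ∣αβ∣ (t ℕ.+ suc t))
      (≡.cong suc (≡.trans (≡.cong (∣αβ∣ ℕ.+_) (ℕ.+-suc t t)) (ℕ.+-suc ∣αβ∣ (t ℕ.+ t))))) deg
      where ∣αβ∣ = Vec.sum α ℕ.+ Vec.sum β

    deg₀ : (Vec.sum α ℕ.+ Vec.sum β) ℕ.+ (t ℕ.+ t) ≤ s ℕ.+ s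
    deg₀ = ℕ.≤-trans (ℕ.m≤n+m _ 2) deg-2

    deg₁ : ∀ c → (Vec.sum (up c α) ℕ.+ Vec.sum (up c β)) ℕ.+ (t ℕ.+ t) ≤ s ℕ.+ s
    deg₁ c = ≡.subst (ℕ._≤ s ℕ.+ s) (≡.cong (ℕ._+ (t ℕ.+ t)) (≡.sym (≡.trans
      (≡.cong₂ ℕ._+_ (sum-raise c 1 α) (sum-raise c 1 β)) (≡.cong suc (ℕ.+-suc _ _))))) deg-2

    deg₂ : ∀ c → (Vec.sum (up c (up c α)) ℕ.+ Vec.sum β) ℕ.+ (t ℕ.+ t) ≤ s ℕ.+ s
    deg₂ c = ≡.subst (ℕ._≤ s ℕ.+ s) (≡.cong (λ d → (d ℕ.+ Vec.sum β) ℕ.+ (t ℕ.+ t)) (≡.sym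
      (≡.trans (sum-raise c 1 (up c α)) (≡.cong suc (sum-raise c 1 α))))) deg-2

    deg₃ : ∀ c → (Vec.sum α ℕ.+ Vec.sum (up c (up c β))) ℕ.+ (t ℕ.+ t) ≤ s ℕ.+ s
    deg₃ c = ≡.subst (ℕ._≤ s ℕ.+ s) (≡.cong (ℕ._+ (t ℕ.+ t)) (≡.sym (≡.trans
      (≡.cong (Vec.sum α ℕ.+_) (≡.trans (sum-raise c 1 (up c β)) (≡.cong suc (sum-raise c 1 β))))
      (≡.trans (ℕ.+-suc _ _) (≡.cong suc (ℕ.+-suc _ _)))))) deg-2

    expand : ∀ a b x y w → (a * b) * ((D zero - sqDist x y) * w) ≈
             D zero * ((a * b) * w) + (- 1#) * sum (λ c → sq x y c * ((a * b) * w))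
    expand a b x y w = begin
      (a * b) * ((D zero + - sqDist x y) * w)
        ≈⟨ *-congˡ (*-congʳ (+-congˡ (sym (-1*x≈-x _)))) ⟩
      (a * b) * ((D zero + (- 1#) * sqDist x y) * w)
        ≈⟨ solve 6 (λ a b d n s w → (a :* b) :* ((d :+ n :* s) :* w) :=
             d :* ((a :* b) :* w) :+ n :* (s :* ((a :* b) :* w)))
             refl a b (D zero) (- 1#) (sqDist x y) w ⟩
      D zero * ((a * b) * w) + (- 1#) * (sqDist x y * ((a * b) * w))
        ≈⟨ +-congˡ (*-congˡ (*-distribʳ-sum ((a * b) * w) (sq x y))) ⟩
      D zero * ((a * b) * w) + (- 1#) * sum (λ c → sq x y c * ((a * b) * w)) ∎

    term : ∀ c i j → sq (p i) (p j) c * T i j ≈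
           ((eval (up c (up c α)) (p i) * eval β (p j)) * W i j +
            (eval α (p i) * eval (up c (up c β)) (p j)) * W i j) +
           (- (1# + 1#)) * ((eval (up c α) (p i) * eval (up c β) (p j)) * W i j)
    term c i j = begin
      sq (p i) (p j) c * T i j
        ≈⟨ *-congʳ (square-expand x y) ⟩
      ((x * x + y * y) + (- (1# + 1#)) * (x * y)) * ((a * b) * w)
        ≈⟨ solve 6 (λ x y k a b w → ((x :* x :+ y :* y) :+ k :* (x :* y)) :* ((a :* b) :* w) :=
             (((x :* (x :* a)) :* b) :* w :+ (a :* (y :* (y :* b))) :* w) :+
             k :* (((x :* a) :* (y :* b)) :* w)) refl x y (- (1# + 1#)) a b w ⟩
      (((x * (x * a)) * b) * w + (a * (y * (y * b))) * w) + (- (1# + 1#)) * (((x * a) * (y * b)) * w)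
        ≈⟨ +-cong (+-cong (*-congʳ (*-congʳ (eval-up² c α (p i)))) (*-congʳ (*-congˡ (eval-up² c β (p j)))))
                  (*-congˡ (*-congʳ (*-cong (eval-up c α (p i)) (eval-up c β (p j))))) ⟨
      _ ∎
      where
      x = p i c
      y = p j c
      a = eval α (p i)
      b = eval β (p j)
      w = W i j

  -- The matrix has the monomials `μ r` as rows and the points as columns. That `D` contains every
  -- squared distance is assumed only in doubly negated form; this suffices because it is used to
  -- show that entries of P vanish, which is a stable statement.
  fewDistances⇒≤ :
    ∀ {m n q s t N} (p : Fin m → Vector Carrier n) (a : Fin n → Vector Carrier q) →
    (∀ i c → ∃ λ l → p i c ≈ a c l) →
    t ≤ s → (D : Vector Carrier t) → (∀ l → ¬ D l ≈ 0#) →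
    (∀ {i j} → i ≢ j → ¬ (∀ l → ¬ sqDist (p i) (p j) ≈ D l)) →
    (μ : Fin N → Monomial n) → (∀ α → BoundedMonomials n q s α → ∃ λ r → μ r ≡ α) →
    m ≤ N
  fewDistances⇒≤ {m} {n} {q} {s} {t} p a p∈a t≤s D D≉0 covered μ μ-onto =
    trivialKernel⇒≤ (λ r → eval (μ r) ∘ p) kernel
    where
    kernel : ∀ v → (∀ r → v · (eval (μ r) ∘ p) ≈ 0#) → ∀ i → v i ≈ 0#
    kernel v v-ker = squares-sum0 v (*-cancel-0 C _ (nodal-0≉0 D D≉0) (begin
      C * sum (λ i → v i * v i)                      ≈⟨ *-congˡ (·-sum v v) ⟨
      C * v · v                                      ≈⟨ ·-scaleʳ C v v ⟨
      v · (λ i → C * v i)                            ≈⟨ ·-congˡ v diagonal ⟨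
      -- Multiplying by two values of the constant monomial 1 brings the form into the shape of
      -- `form-nodal`, with α and β both zero.
      form v P                                       ≈⟨ form-cong v (λ i j → trans (sym (*-identityˡ _))
                                                          (*-congʳ (trans (sym (*-identityˡ 1#))
                                                          (*-cong (sym (eval-1 (p i))) (sym (eval-1 (p j))))))) ⟩
      form v (λ i j → (eval one (p i) * eval one (p j)) * P i j)
                                                     ≈⟨ form-nodal p v (annihilates-bounded⇒all p a p∈a v bounded) D one one degree ⟩
      0#                                             ∎))
      where
      C : Carrier
      C = nodal D 0#

      P : Fin m → Fin m → Carrier
      P i j = nodal D (sqDist (p i) (p j))

      one : Monomial n
      one = Vec.replicate n 0

      degree : (Vec.sum one ℕ.+ Vec.sum one) ℕ.+ (t ℕ.+ t) ≤ s ℕ.+ s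
      degree = ≡.subst (λ d → (d ℕ.+ d) ℕ.+ (t ℕ.+ t) ≤ s ℕ.+ s) (≡.sym (sum-1 n)) (ℕ.+-mono-≤ t≤s t≤s)

      bounded : ∀ α → BoundedMonomials n q s α → v · (eval α ∘ p) ≈ 0#
      bounded α α∈ with μ-onto α α∈
      ... | r , ≡.refl = v-ker r

      diagonal : ∀ i → v · P i ≈ C * v i
      -- For j different from i, a nonzero entry of P would mean that the squared distance equals no
      -- root `D l`, against `covered`. On the diagonal the squared distance is 0, and P takes the
      -- value C.
      diagonal i = trans (trans (·-sum v (P i)) (sum-single _ i (λ j i≢j → *-0ʳ (v j) (≈0-stable _ (λ P≉0 →
                            covered i≢j (λ l eq → P≉0 (nodal-root D l eq)))))))
                  (trans (*-comm _ _) (*-congʳ (nodal-cong D (sqDist-refl (p i)))))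

-- The Cauchy reals as a formally real domain.

module Reals where

  open import Data.Rational.Base using
    (ℚ; 0ℚ; 1ℚ; _+_; _*_; _-_; -_; _<_; ∣_∣; positive; nonNegative; Positive; NonZero; 1/_)
  open ℚSolver.+-*-Solver using (solve; _:=_; _:+_; _:*_; _:-_; :-_; con)

  -- `x ≈ℝ y` unfolds to `Null` of the termwise difference, so equalities of reals become statements
  -- about null sequences.
  Null : (ℕ → ℚ) → Set
  Null f = ∀ ε → 0ℚ < ε → ∃ λ N → ∀ n → N ℕ.≤ n → ∣ f n ∣ < ε

  Null-dominated : ∀ {f g} → (∀ n → ∣ g n ∣ ℚ.≤ ∣ f n ∣) → Null f → Null g
  Null-dominated g≤f f-null ε 0<ε with f-null ε 0<ε
  ... | N , small = N , λ n N≤n → ℚ.≤-<-trans (g≤f n) (small n N≤n)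

  Null-resp : ∀ {f g} → (∀ n → f n ≡ g n) → Null f → Null g
  Null-resp f≡g = Null-dominated (λ n → ℚ.≤-reflexive (≡.cong ∣_∣ (≡.sym (f≡g n))))

  *-pos : ∀ p q → 0ℚ < p → 0ℚ < q → 0ℚ < p * q
  *-pos p q 0<p 0<q =
    ℚ.positive⁻¹ (p * q) {{ℚ.pos*pos⇒pos p {{positive 0<p}} q {{positive 0<q}}}}

  half third : ℚ → ℚ
  half  ε = ℚ.½ * ε
  third ε = (ℤ.+ 1 ℚ./ 3) * ε

  half>0 : ∀ ε → 0ℚ < ε → 0ℚ < half ε
  half>0 ε = *-pos ℚ.½ ε (ℚ.positive⁻¹ ℚ.½)

  third>0 : ∀ ε → 0ℚ < ε → 0ℚ < third ε
  third>0 ε = *-pos (ℤ.+ 1 ℚ./ 3) ε (ℚ.positive⁻¹ (ℤ.+ 1 ℚ./ 3))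

  half+half : ∀ ε → half ε + half ε ≡ ε
  half+half = solve 1 (λ ε → con ℚ.½ :* ε :+ con ℚ.½ :* ε := ε) ≡.refl

  third+third+third : ∀ ε → third ε + (third ε + third ε) ≡ ε
  third+third+third = solve 1 (λ ε → con ⅓ :* ε :+ (con ⅓ :* ε :+ con ⅓ :* ε) := ε) ≡.refl
    where ⅓ = ℤ.+ 1 ℚ./ 3

  Null-+ : ∀ {f g} → Null f → Null g → Null (λ n → f n + g n)
  Null-+ {f} {g} f-null g-null ε 0<ε
    with f-null (half ε) (half>0 ε 0<ε) | g-null (half ε) (half>0 ε 0<ε)
  ... | M , f-small | N , g-small = M ℕ.⊔ N , λ n ≤n →
    ℚ.≤-<-trans (ℚ.∣p+q∣≤∣p∣+∣q∣ (f n) (g n))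
      (≡.subst (∣ f n ∣ + ∣ g n ∣ <_) (half+half ε)
        (ℚ.+-mono-< (f-small n (ℕ.m⊔n≤o⇒m≤o M N ≤n)) (g-small n (ℕ.m⊔n≤o⇒n≤o M N ≤n))))

  Null-neg : ∀ {f} → Null f → Null (λ n → - f n)
  Null-neg {f} = Null-dominated (λ n → ℚ.≤-reflexive (ℚ.∣-p∣≡∣p∣ (f n)))

  divide : ∀ B ε → 0ℚ < B → 0ℚ < ε → ∃ λ η → 0ℚ < η × B * η ≡ ε
  divide B ε 0<B 0<ε = 1/ B * ε
    , *-pos (1/ B) ε (ℚ.positive⁻¹ (1/ B) {{ℚ.1/pos⇒pos B}}) 0<ε
    , ≡.trans (≡.sym (ℚ.*-assoc B (1/ B) ε))
     (≡.trans (≡.cong (_* ε) (ℚ.*-inverseʳ B)) (ℚ.*-identityˡ ε))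
    where
    instance
      B-pos : Positive B
      B-pos = positive 0<B
      B-nonZero : NonZero B
      B-nonZero = ℚ.pos⇒nonZero B

  product-< : ∀ {x y B η ε} → 0ℚ < B → B * η ≡ ε → ∣ x ∣ ℚ.≤ B → ∣ y ∣ < η → ∣ x * y ∣ < ε
  product-< {x} {y} {B} {η} {ε} 0<B Bη≡ε x≤B y<η = ≡.subst₂ _<_ (≡.sym (ℚ.∣p*q∣≡∣p∣*∣q∣ x y)) Bη≡ε
    (ℚ.≤-<-trans (ℚ.*-monoʳ-≤-nonNeg ∣ y ∣ {{ℚ.∣-∣-nonNeg y}} x≤B)
                 (ℚ.*-monoʳ-<-pos B {{positive 0<B}} y<η))

  Null-bounded-* : ∀ {f g : ℕ → ℚ} {B M} → 0ℚ < B → (∀ n → M ℕ.≤ n → ∣ f n ∣ ℚ.≤ B) →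
                   Null g → Null (λ n → f n * g n)
  Null-bounded-* {f} {g} {B} {M} 0<B f≤B g-null ε 0<ε = conclude (divide B ε 0<B 0<ε)
    where
    conclude : (∃ λ η → 0ℚ < η × B * η ≡ ε) → ∃ λ N → ∀ n → N ℕ.≤ n → ∣ f n * g n ∣ < ε
    conclude (η , 0<η , Bη≡ε) with g-null η 0<η
    ... | N , g-small = M ℕ.⊔ N , λ n ≤n → product-< {f n} {g n} {B} {η} 0<B Bη≡ε
      (f≤B n (ℕ.m⊔n≤o⇒m≤o M N ≤n)) (g-small n (ℕ.m⊔n≤o⇒n≤o M N ≤n))

  Null-* : ∀ x {g} → Null g → Null (λ n → seq x n * g n)
  Null-* x {g} g-null = Null-bounded-* {seq x} {g} {proj₁ bound} {proj₁ (proj₂ bound)}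
    (proj₁ (proj₂ (proj₂ bound))) (proj₂ (proj₂ (proj₂ bound))) g-null
    where bound = eventuallyBounded x

  1ℝ : ℝ
  1ℝ = mkℝ (λ _ → 1ℚ) (λ ε 0<ε → 0 , λ _ _ _ _ → 0<ε)

  ≗⇒≈ : ∀ x y → (∀ n → seq x n ≡ seq y n) → x ≈ℝ y
  ≗⇒≈ x y x≗y = Null-resp (λ n → ≡.trans (≡.sym (ℚ.+-inverseʳ (seq x n))) (≡.cong (λ t → seq x n - t) (x≗y n)))
                          (λ ε 0<ε → 0 , λ _ _ → 0<ε)

  +ℝ-cong : ∀ x x′ y y′ → x ≈ℝ x′ → y ≈ℝ y′ → (x +ℝ y) ≈ℝ (x′ +ℝ y′)
  +ℝ-cong x x′ y y′ x≈ y≈ = Null-resp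
    (λ n → solve 4 (λ a a′ b b′ → (a :- a′) :+ (b :- b′) := (a :+ b) :- (a′ :+ b′)) ≡.refl
             (seq x n) (seq x′ n) (seq y n) (seq y′ n))
    (Null-+ x≈ y≈)

  *ℝ-cong : ∀ x x′ y y′ → x ≈ℝ x′ → y ≈ℝ y′ → (x *ℝ y) ≈ℝ (x′ *ℝ y′)
  *ℝ-cong x x′ y y′ x≈ y≈ = Null-resp
    (λ n → solve 4 (λ a a′ b b′ → a :* (b :- b′) :+ b′ :* (a :- a′) := a :* b :- a′ :* b′) ≡.refl
             (seq x n) (seq x′ n) (seq y n) (seq y′ n))
    (Null-+ (Null-* x y≈) (Null-* y′ x≈))

  -ℝ-cong : ∀ x x′ → x ≈ℝ x′ → (-ℝ x) ≈ℝ (-ℝ x′)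
  -ℝ-cong x x′ x≈ = Null-resp
    (λ n → solve 2 (λ a a′ → :- (a :- a′) := :- a :- :- a′) ≡.refl (seq x n) (seq x′ n))
    (Null-neg x≈)

  -- The ring laws hold termwise in ℚ; estimates enter only through the congruences.
  ℝ-commutativeRing : CommutativeRing 0ℓ 0ℓ
  ℝ-commutativeRing = record
    { Carrier = ℝ
    ; _≈_     = _≈ℝ_
    ; _+_     = _+ℝ_
    ; _*_     = _*ℝ_
    ; -_      = -ℝ_
    ; 0#      = 0ℝ
    ; 1#      = 1ℝ
    ; isCommutativeRing = record
      { isRing = record
        { +-isAbelianGroup = record
          { isGroup = record
            { isMonoid = record
              { isSemigroup = record
                { isMagma = record
                  { isEquivalence = Setoid.isEquivalence ℝ-setoid
                  ; ∙-cong        = λ {x} {x′} {y} {y′} → +ℝ-cong x x′ y y′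
                  }
                ; assoc = λ x y z → ≗⇒≈ ((x +ℝ y) +ℝ z) (x +ℝ (y +ℝ z)) (λ n → ℚ.+-assoc (seq x n) (seq y n) (seq z n))
                }
              ; identity = (λ x → ≗⇒≈ (0ℝ +ℝ x) x (λ n → ℚ.+-identityˡ (seq x n)))
                         , (λ x → ≗⇒≈ (x +ℝ 0ℝ) x (λ n → ℚ.+-identityʳ (seq x n)))
              }
            ; inverse = (λ x → ≗⇒≈ ((-ℝ x) +ℝ x) 0ℝ (λ n → ℚ.+-inverseˡ (seq x n)))
                      , (λ x → ≗⇒≈ (x -ℝ x) 0ℝ (λ n → ℚ.+-inverseʳ (seq x n)))
            ; ⁻¹-cong = λ {x} {x′} → -ℝ-cong x x′
            }
          ; comm = λ x y → ≗⇒≈ (x +ℝ y) (y +ℝ x) (λ n → ℚ.+-comm (seq x n) (seq y n))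
          }
        ; *-cong     = λ {x} {x′} {y} {y′} → *ℝ-cong x x′ y y′
        ; *-assoc    = λ x y z → ≗⇒≈ ((x *ℝ y) *ℝ z) (x *ℝ (y *ℝ z)) (λ n → ℚ.*-assoc (seq x n) (seq y n) (seq z n))
        ; *-identity = (λ x → ≗⇒≈ (1ℝ *ℝ x) x (λ n → ℚ.*-identityˡ (seq x n)))
                     , (λ x → ≗⇒≈ (x *ℝ 1ℝ) x (λ n → ℚ.*-identityʳ (seq x n)))
        ; distrib    = (λ x y z → ≗⇒≈ (x *ℝ (y +ℝ z)) (x *ℝ y +ℝ x *ℝ z) (λ n → ℚ.*-distribˡ-+ (seq x n) (seq y n) (seq z n)))
                     , (λ x y z → ≗⇒≈ ((y +ℝ z) *ℝ x) (y *ℝ x +ℝ z *ℝ x) (λ n → ℚ.*-distribʳ-+ (seq x n) (seq y n) (seq z n)))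
        }
      ; *-comm = λ x y → ≗⇒≈ (x *ℝ y) (y *ℝ x) (λ n → ℚ.*-comm (seq x n) (seq y n))
      }
    }

  -- Apartness from zero, stability and cancellation.

  ≈0⇒Null : ∀ x → x ≈ℝ 0ℝ → Null (seq x)
  ≈0⇒Null x = Null-resp (λ n → ℚ.+-identityʳ (seq x n))

  Null⇒≈0 : ∀ x → Null (seq x) → x ≈ℝ 0ℝ
  Null⇒≈0 x = Null-resp (λ n → ≡.sym (ℚ.+-identityʳ (seq x n)))

  -- A positive form of being nonzero: unlike the negation of `x ≈ℝ 0ℝ`, it supplies a rational
  -- lower bound to compute with.
  Apart : ℝ → Set
  Apart x = ∃₂ λ δ N → 0ℚ < δ × (∀ n → N ℕ.≤ n → δ ℚ.≤ ∣ seq x n ∣)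

  Apart⇒≉0 : ∀ x → Apart x → ¬ x ≈ℝ 0ℝ
  Apart⇒≉0 x (δ , M , 0<δ , δ≤x) x≈0 with ≈0⇒Null x x≈0 δ 0<δ
  ... | N , x<δ = ℚ.<-irrefl ≡.refl
    (ℚ.≤-<-trans (δ≤x (M ℕ.⊔ N) (ℕ.m≤m⊔n M N)) (x<δ (M ℕ.⊔ N) (ℕ.m≤n⊔m M N)))

  -- For each ε, one sufficiently late term decides between ∣x∣ < ε eventually
  -- and x being apart from 0.
  ¬Apart⇒≈0 : ∀ x → ¬ Apart x → x ≈ℝ 0ℝ
  ¬Apart⇒≈0 x ¬apart = Null⇒≈0 x null
    where
    null : Null (seq x)
    null ε 0<ε with cauchy x (third ε) (third>0 ε 0<ε)
    -- The threshold 2ε/3 leaves a margin of ε/3 on both sides: a term below it keeps all later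
    -- terms below ε, any other keeps them at least ε/3.
    ... | N , close with ∣ seq x N ∣ ℚ.<? third ε + third ε
    ... | yes small = N , λ n N≤n → ≡.subst₂ _<_
            (≡.cong ∣_∣ (solve 2 (λ a b → (a :- b) :+ b := a) ≡.refl (seq x n) (seq x N)))
            (third+third+third ε)
            (ℚ.≤-<-trans (ℚ.∣p+q∣≤∣p∣+∣q∣ (seq x n - seq x N) (seq x N))
                         (ℚ.+-mono-< (close n N N≤n ℕ.≤-refl) small))
    ... | no  large = ⊥-elim (¬apart (third ε , N , third>0 ε 0<ε , λ n N≤n →
            ℚ.≮⇒≥ (λ xₙ<ε/3 → large (ℚ.≤-<-trans
              (≡.subst (ℚ._≤ ∣ seq x N - seq x n ∣ + ∣ seq x n ∣)
                (≡.cong ∣_∣ (solve 2 (λ a b → (a :- b) :+ b := a) ≡.refl (seq x N) (seq x n)))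
                (ℚ.∣p+q∣≤∣p∣+∣q∣ (seq x N - seq x n) (seq x n)))
              (ℚ.+-mono-< (close N n ℕ.≤-refl N≤n) xₙ<ε/3)))))

  -- Apartness refutes `x ≈ℝ 0ℝ`, so the double negation refutes apartness, and that already yields
  -- equality.
  ≈0ℝ-stable : ∀ x → ¬ ¬ x ≈ℝ 0ℝ → x ≈ℝ 0ℝ
  ≈0ℝ-stable x ¬x≉0 = ¬Apart⇒≈0 x (¬x≉0 ∘ Apart⇒≉0 x)

  -- If y were apart from 0 with bound δ, then eventually |x| δ ≤ |xy| < εδ, so x would be null.
  *ℝ-cancel-0 : ∀ x y → ¬ x ≈ℝ 0ℝ → (x *ℝ y) ≈ℝ 0ℝ → y ≈ℝ 0ℝ
  *ℝ-cancel-0 x y x≉0 xy≈0 = ¬Apart⇒≈0 y (λ apart → x≉0 (Null⇒≈0 x (null apart)))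
    where
    null : Apart y → Null (seq x)
    null (δ , M , 0<δ , δ≤y) ε 0<ε with ≈0⇒Null (x *ℝ y) xy≈0 (ε * δ) (*-pos ε δ 0<ε 0<δ)
    ... | N , xy<εδ = M ℕ.⊔ N , λ n ≤n →
      ℚ.*-cancelʳ-<-nonNeg δ {{nonNegative (ℚ.<⇒≤ 0<δ)}}
        (ℚ.≤-<-trans (ℚ.*-monoˡ-≤-nonNeg ∣ seq x n ∣ {{ℚ.∣-∣-nonNeg (seq x n)}}
                       (δ≤y n (ℕ.m⊔n≤o⇒m≤o M N ≤n)))
          (≡.subst (_< ε * δ) (ℚ.∣p*q∣≡∣p∣*∣q∣ (seq x n) (seq y n)) (xy<εδ n (ℕ.m⊔n≤o⇒n≤o M N ≤n))))

  1ℝ≉0 : ¬ 1ℝ ≈ℝ 0ℝ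
  1ℝ≉0 = Apart⇒≉0 1ℝ (1ℚ , 0 , ℚ.positive⁻¹ 1ℚ , λ _ _ → ℚ.≤-refl)

  -- Sums of squares and the square of the distance.

  sumSquares : ∀ {n} → Vector ℝ n → ℝ
  sumSquares v = foldr _+ℝ_ 0ℝ (λ i → v i *ℝ v i)

  0≤p*p : ∀ p → 0ℚ ℚ.≤ p * p
  0≤p*p p = ≡.subst (0ℚ ℚ.≤_) (∣p∣²≡p²)
    (ℚ.nonNegative⁻¹ (∣ p ∣ * ∣ p ∣)
      {{ℚ.nonNeg*nonNeg⇒nonNeg (∣ p ∣) {{ℚ.∣-∣-nonNeg p}} (∣ p ∣) {{ℚ.∣-∣-nonNeg p}}}})
    where
    ∣p∣²≡p² : ∣ p ∣ * ∣ p ∣ ≡ p * p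
    ∣p∣²≡p² with ℚ.∣p∣≡p∨∣p∣≡-p p
    ... | inj₁ eq = ≡.cong₂ _*_ eq eq
    ... | inj₂ eq = ≡.trans (≡.cong₂ _*_ eq eq) (solve 1 (λ p → :- p :* :- p := p :* p) ≡.refl p)

  sumSquares≥0 : ∀ {k} (v : Vector ℝ k) n → 0ℚ ℚ.≤ seq (sumSquares v) n
  sumSquares≥0 {zero}  v n = ℚ.≤-refl
  sumSquares≥0 {suc k} v n = ℚ.+-mono-≤ (0≤p*p (seq (v zero) n)) (sumSquares≥0 (v ∘ suc) n)

  ≤-≈0 : ∀ x y → (∀ n → 0ℚ ℚ.≤ seq x n) → (∀ n → seq x n ℚ.≤ seq y n) → y ≈ℝ 0ℝ → x ≈ℝ 0ℝ
  ≤-≈0 x y 0≤x x≤y y≈0 = Null⇒≈0 x (Null-dominated (λ n → ≡.subst₂ ℚ._≤_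
    (≡.sym (ℚ.0≤p⇒∣p∣≡p (0≤x n))) (≡.sym (ℚ.0≤p⇒∣p∣≡p (ℚ.≤-trans (0≤x n) (x≤y n)))) (x≤y n))
    (≈0⇒Null y y≈0))

  p≤p+q : ∀ p q → 0ℚ ℚ.≤ q → p ℚ.≤ p + q
  p≤p+q p q 0≤q = ≡.subst (ℚ._≤ p + q) (ℚ.+-identityʳ p) (ℚ.+-monoʳ-≤ p 0≤q)

  q≤p+q : ∀ p q → 0ℚ ℚ.≤ p → q ℚ.≤ p + q
  q≤p+q p q 0≤p = ≡.subst (q ℚ.≤_) (ℚ.+-comm q p) (p≤p+q q p 0≤p)

  -- Termwise, the first square and the sum of the others both lie between 0 and the whole sum,
  -- hence are null with it. A null square x * x gives x ≈ 0 by cancellation and stability.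
  sumSquares≈0 : ∀ {k} (v : Vector ℝ k) → sumSquares v ≈ℝ 0ℝ → ∀ i → v i ≈ℝ 0ℝ
  sumSquares≈0 v Σ≈0 zero = ≈0ℝ-stable x (λ x≉0 → x≉0 (*ℝ-cancel-0 x x x≉0
    (≤-≈0 (x *ℝ x) (sumSquares v) (λ n → 0≤p*p (seq x n))
      (λ n → p≤p+q (seq x n * seq x n) (seq (sumSquares (v ∘ suc)) n) (sumSquares≥0 (v ∘ suc) n)) Σ≈0)))
    where
    x : ℝ
    x = v zero
  sumSquares≈0 v Σ≈0 (suc i) = sumSquares≈0 (v ∘ suc)
    (≤-≈0 (sumSquares (v ∘ suc)) (sumSquares v) (sumSquares≥0 (v ∘ suc))
      (λ n → q≤p+q (seq (v zero) n * seq (v zero) n) (seq (sumSquares (v ∘ suc)) n)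
        (0≤p*p (seq (v zero) n))) Σ≈0) i

  ℝ-formallyRealDomain : FormallyRealDomain 0ℓ 0ℓ
  ℝ-formallyRealDomain = record
    { commutativeRing = ℝ-commutativeRing
    ; ≈0-stable       = ≈0ℝ-stable
    ; *-cancel-0      = *ℝ-cancel-0
    ; 1≉0             = 1ℝ≉0
    ; squares-sum0    = sumSquares≈0
    }

  dist² : ∀ {n} (x y : Point n) → (dist x y *ℝ dist x y) ≈ℝ sumSquares (λ c → x c -ℝ y c)
  dist² x y = sqrt-square (sumSquares (λ c → x c -ℝ y c)) (sumSquares≥0 (λ c → x c -ℝ y c))

-- Squared distances between real points.

module RealDistances where
  open Reals
  open Polynomials ℝ-formallyRealDomain using (sqDist)

  -- Proved termwise: a conversion check of the two reals would unfold their
  -- Cauchy moduli, which is prohibitively slow.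
  sqDist≗ : ∀ {n} (x y : Point n) k → seq (sqDist x y) k ≡ seq (sumSquares (λ c → x c -ℝ y c)) k
  sqDist≗ {zero}  x y k = ≡.refl
  sqDist≗ {suc n} x y k = ≡.cong (seq ((x zero -ℝ y zero) *ℝ (x zero -ℝ y zero)) k ℚ.+_) (sqDist≗ (x ∘ suc) (y ∘ suc) k)

  sumSquares≈δ² : ∀ {n} (x y : Point n) δ → dist x y ≈ℝ δ → sumSquares (λ c → x c -ℝ y c) ≈ℝ (δ *ℝ δ)
  sumSquares≈δ² x y δ dist≈δ = ≈-trans {sumSquares (λ c → x c -ℝ y c)} {dist x y *ℝ dist x y} {δ *ℝ δ}
    (≈-sym {dist x y *ℝ dist x y} {sumSquares (λ c → x c -ℝ y c)} (dist² x y))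
    (*ℝ-cong (dist x y) δ (dist x y) δ dist≈δ dist≈δ)

  sqDist≈δ² : ∀ {n} (x y : Point n) δ → dist x y ≈ℝ δ → sqDist x y ≈ℝ (δ *ℝ δ)
  sqDist≈δ² x y δ dist≈δ = ≈-trans {sqDist x y} {sumSquares (λ c → x c -ℝ y c)} {δ *ℝ δ}
    (≗⇒≈ (sqDist x y) (sumSquares (λ c → x c -ℝ y c)) (sqDist≗ x y)) (sumSquares≈δ² x y δ dist≈δ)

-- Maximal finite families in a set of bounded cardinality.

module _ {a ℓ p} (S : Setoid a ℓ) (P : Pred (Setoid.Carrier S) p) where

  open Setoid S using (_≈_)

  extend : ∀ {t} (g : Injection (setoid (Fin t)) (S ∣ P)) d → P d →
           (∀ l → ¬ d ≈ proj₁ (Injection.to g l)) → Injection (setoid (Fin (suc t))) (S ∣ P)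
  extend {t} g d d∈P d∉g = record
    { to        = to
    ; cong      = λ { ≡.refl → Setoid.refl S }
    ; injective = λ {i} {j} → injective i j
    }
    where
    to : Fin (suc t) → Setoid.Carrier (S ∣ P)
    to zero    = d , d∈P
    to (suc l) = Injection.to g l
    injective : ∀ i j → proj₁ (to i) ≈ proj₁ (to j) → i ≡ j
    injective zero    zero    _  = ≡.refl
    injective zero    (suc j) eq = ⊥-elim (d∉g j eq)
    injective (suc i) zero    eq = ⊥-elim (d∉g i (Setoid.sym S eq))
    injective (suc i) (suc j) eq = ≡.cong suc (Injection.injective g eq)

  MaximalInjection : ℕ → Set _
  MaximalInjection s = ∃ λ t → t ≤ s × ∃ λ (g : Injection (setoid (Fin t)) (S ∣ P)) →
                       ∀ d → P d → ¬ (∀ l → ¬ d ≈ proj₁ (Injection.to g l))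

  -- Otherwise injections could be extended beyond every size.
  maximalInjection : ∀ {s} → CardinalityAtMost S P s → ¬ ¬ MaximalInjection s
  maximalInjection {s} atMost ¬maximal = unbounded (suc s) (λ g → ℕ.<-irrefl ≡.refl (atMost g))
    where
    unbounded : ∀ t → ¬ ¬ Injection (setoid (Fin t)) (S ∣ P)
    unbounded zero    none = none (record { to = λ () ; cong = λ { {()} } ; injective = λ { {()} } })
    -- If no injection of size t + 1 exists, one of size t cannot be extended and is therefore
    -- maximal.
    unbounded (suc t) none = unbounded t (λ g → ¬maximal
      (t , atMost g , g , λ d d∈P d∉g → none (extend g d d∈P d∉g)))

-- The bound for subsets of a box with few distances.

open import Data.Nat.Base using (_*_)

theorem1p4 : ∀ {a f : Level} (n q s : ℕ) → 1 ≤ n → 2 ≤ q →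
    (A : Fin n → Pred ℝ a) → (∀ i → HasCardinality ℝ-setoid (A i) q) →
    (F : Pred (Point n) f) → F ⊆ Box A →
    CardinalityAtMost ℝ-setoid (Distances F) s →
    ∀ (N : ℕ) → HasCardinality (setoid (Monomial n)) (BoundedMonomials n q s) N →
    CardinalityAtMost (Point-setoid n) F (2 * N)
theorem1p4 n q s _ _ A ∣A∣≡q F F⊆B ∣dF∣≤s N ∣M∣≡N {m} F-points =
  -- A maximal family of distances exists only up to double negation, which decidability of m ≤ N
  -- removes. The factor 2 is then reached from N ≤ N + (N + 0).
  ℕ.≤-trans (decidable-stable (m ℕ.≤? N) (λ m≰N →
    maximalInjection ℝ-setoid (Distances F) ∣dF∣≤s (m≰N ∘ bound))) (ℕ.m≤m+n N (N ℕ.+ 0))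
  where
  open Reals
  open RealDistances
  open Polynomials ℝ-formallyRealDomain using (fewDistances⇒≤; sqDist)
  open RingProperties (CommutativeRing.ring ℝ-commutativeRing) using (x∙y⁻¹≈ε⇒x≈y)

  p : Fin m → Point n
  p i = proj₁ (Injection.to F-points i)

  roots : (c : Fin n) → Vector ℝ q
  roots c l = proj₁ (Bijection.to (∣A∣≡q c) l)

  p∈roots : ∀ i c → ∃ λ l → p i c ≈ℝ roots c l
  p∈roots i c = proj₁ root , ≈-sym {roots c (proj₁ root)} {p i c} (proj₂ root)
    where root = Bijection.strictlySurjective (∣A∣≡q c) (p i c , F⊆B (proj₂ (Injection.to F-points i)) c)

  monomials : Fin N → Monomial n
  monomials r = proj₁ (Bijection.to ∣M∣≡N r)

  monomials-onto : ∀ α → BoundedMonomials n q s α → ∃ λ r → monomials r ≡ α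
  monomials-onto α α∈ = Bijection.strictlySurjective ∣M∣≡N (α , α∈)

  -- The square of δ is the sum of the squared coordinate differences; were it 0, all coordinates of
  -- the two points would agree.
  distance²≉0 : ∀ δ → Distances F δ → ¬ (δ *ℝ δ) ≈ℝ 0ℝ
  distance²≉0 δ (x , y , _ , _ , x≉y , δ≈dist) δ²≈0 = x≉y (λ c → x∙y⁻¹≈ε⇒x≈y (x c) (y c)
    (sumSquares≈0 (λ c → x c -ℝ y c)
      (≈-trans {sumSquares (λ c → x c -ℝ y c)} {δ *ℝ δ} {0ℝ}
        (sumSquares≈δ² x y δ (≈-sym {δ} {dist x y} δ≈dist)) δ²≈0) c))

  bound : MaximalInjection ℝ-setoid (Distances F) s → m ≤ N
  bound (t , t≤s , g , maximal) =
    fewDistances⇒≤ p roots p∈roots t≤s D D≉0 covered monomials monomials-onto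
    where
    δ : Vector ℝ t
    δ l = proj₁ (Injection.to g l)

    D : Vector ℝ t
    D l = δ l *ℝ δ l

    D≉0 : ∀ l → ¬ D l ≈ℝ 0ℝ
    D≉0 l = distance²≉0 (δ l) (proj₂ (Injection.to g l))

    -- If the squared distance differs from every `D l`, the distance differs from every `δ l` and
    -- could be added to the maximal family.
    covered : ∀ {i j} → i ≢ j → ¬ (∀ l → ¬ sqDist (p i) (p j) ≈ℝ D l)
    covered {i} {j} i≢j uncovered = maximal (dist (p i) (p j))
      (p i , p j , proj₂ (Injection.to F-points i) , proj₂ (Injection.to F-points j) ,
       (λ eq → i≢j (Injection.injective F-points eq)) , ≈-refl {dist (p i) (p j)})
      (λ l eq → uncovered l (sqDist≈δ² (p i) (p j) (δ l) eq))
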